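{- For any positive integer $q$, a $\overline{3}$-separable $t\times n$ Boolean matrix that has a time-optimal analysis algorithm can be constructed with $t=2q^2-2q$ and $n=2^q$.
   Context: A $t\times n$ Boolean matrix $M$ models a non-adaptive group testing regimen: the $n$ columns correspond to items, the $t$ rows to tests, and a test includes exactly the items whose columns have a 1-entry in that row. All tests are conducted before the result of any test is available. Given an unknown set of defective items, the outcome of a test is positive if the test includes at least one defective item and negative otherwise. $M$ is $\overline{d}$-separable if the Boolean sums (entrywise OR) of up to $d$ columns are all distinct, so that each selection of up to $d$ defective items induces a different set of positive tests. An analysis algorithm uses the results of the $t$ tests to determine which of the $n$ items are defective (here, when it is known that at most three are defective). Let $A(n,t)$ denote the analysis time needed to determine which items are defective, where $n$ is the number of items and $t$ the number of tests conducted. The analysis algorithm is time-optimal if $A(n,t)$ is $O(t)$.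
   Formalization: The claim is stated for every q ≥ 2 instead of every positive q: at q = 1 there are t = 0 tests and n = 2 items, so all Boolean sums coincide and no such matrix is separable. -}

module Defs where

open import Data.Bool.Base using (Bool; true; false; if_then_else_; _∧_; _∨_)
open import Data.Fin.Base using (Fin; toℕ; zero)
open import Data.Fin.Subset using (Subset; ∣_∣; _∈_; ⊥; ⁅_⁆)
open import Data.Nat.Base using (ℕ; zero; suc; _+_; _*_; _∸_; _^_; _≤_; _<_; _≡ᵇ_; z≤n; s≤s)
open import Data.Product.Base using (Σ-syntax; ∃-syntax; _×_; _,_)
open import Data.Unit.Base using (⊤)
open import Data.Vec.Base using (Vec; []; _∷_; map; zipWith; foldr′)
open import Function.Bundles using (_⇔_)
open import Relation.Binary.PropositionalEquality using (_≡_; _≢_; refl)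
open import Relation.Nullary.Negation using (¬_)

-- Rows are tests, columns are items.
Matrix : ℕ → ℕ → Set
Matrix t n = Vec (Vec Bool n) t

-- Entrywise OR of the columns of M selected by S.  Equivalently, the vector of
-- test outcomes when S is the set of defective items.
booleanSum : ∀ {t n} → Matrix t n → Subset n → Vec Bool t
booleanSum M S = map (λ row → foldr′ _∨_ false (zipWith _∧_ S row)) M

-- d̄-separability: S and T may have different sizes, and may be empty.
Separable : ∀ {t n} → ℕ → Matrix t n → Set
Separable d M = ∀ S T → ∣ S ∣ ≤ d → ∣ T ∣ ≤ d →
                booleanSum M S ≡ booleanSum M T → S ≡ T

-- With q = 1 the parameters t = 2q² - 2q and n = 2^q leave no test for two
-- items, so separability fails; hence the restriction to q ≥ 2.
¬separable-q≡1 : (M : Matrix (2 * 1 ^ 2 ∸ 2 * 1) (2 ^ 1)) → ¬ Separable 3 M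
¬separable-q≡1 [] sep with sep ⊥ ⁅ zero ⁆ z≤n (s≤s z≤n) refl
... | ()

-- The machine model is a unit-cost word RAM with structured control: registers
-- named by naturals, and one memory accessed by computed address.  There is no
-- multiplication, shift or bitwise operation.

Reg : Set
Reg = ℕ

infixl 6 _⊕_ _⊖_

data Expr : Set where
  lit     : ℕ → Expr
  get     : Reg → Expr
  load    : Expr → Expr
  _⊕_ _⊖_ : Expr → Expr → Expr

infix  5 _≔_
infixr 4 _⨾_

data Program : Set where
  skip   : Program
  _≔_    : Reg → Expr → Program
  store  : (address value : Expr) → Program
  _⨾_    : Program → Program → Program
  ifnz   : Expr → Program → Program → Program
  while  : Expr → Program → Program

record State : Set where
  constructor ⟨_,_⟩
  field
    reg : ℕ → ℕ
    mem : ℕ → ℕ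

open State public

_[_↦_] : (ℕ → ℕ) → ℕ → ℕ → (ℕ → ℕ)
(f [ a ↦ v ]) b = if a ≡ᵇ b then v else f b

⟦_⟧ : Expr → State → ℕ
⟦ lit k  ⟧ s = k
⟦ get r  ⟧ s = reg s r
⟦ load e ⟧ s = mem s (⟦ e ⟧ s)
⟦ e ⊕ f  ⟧ s = ⟦ e ⟧ s + ⟦ f ⟧ s
⟦ e ⊖ f  ⟧ s = ⟦ e ⟧ s ∸ ⟦ f ⟧ s

-- Each node of an expression is one unit-cost operation.
size : Expr → ℕ
size (lit k)  = 1
size (get r)  = 1
size (load e) = suc (size e)
size (e ⊕ f)  = suc (size e + size f)
size (e ⊖ f)  = suc (size e + size f)

-- No addition performed while evaluating the expression exceeds the largest
-- word B.  Only addition can produce a value larger than those already present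
-- in the state and the (constantly many) literals of the program.
NoOverflow : ℕ → Expr → State → Set
NoOverflow B (lit k)  s = ⊤
NoOverflow B (get r)  s = ⊤
NoOverflow B (load e) s = NoOverflow B e s
NoOverflow B (e ⊕ f)  s = NoOverflow B e s × NoOverflow B f s × ⟦ e ⟧ s + ⟦ f ⟧ s ≤ B
NoOverflow B (e ⊖ f)  s = NoOverflow B e s × NoOverflow B f s

-- Run B P s k s′: started in s, P halts in s′ after k steps without overflow.
data Run (B : ℕ) : Program → State → ℕ → State → Set where

  run-skip  : ∀ {s} → Run B skip s 0 s

  run-≔     : ∀ {s r e} → NoOverflow B e s →
              Run B (r ≔ e) s (suc (size e)) ⟨ reg s [ r ↦ ⟦ e ⟧ s ] , mem s ⟩

  run-store : ∀ {s e f} → NoOverflow B e s → NoOverflow B f s →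
              Run B (store e f) s (suc (size e + size f))
                ⟨ reg s , mem s [ ⟦ e ⟧ s ↦ ⟦ f ⟧ s ] ⟩

  run-⨾     : ∀ {P Q s s′ s″ k l} → Run B P s k s′ → Run B Q s′ l s″ →
              Run B (P ⨾ Q) s (k + l) s″

  run-then  : ∀ {e P Q s s′ k} → NoOverflow B e s → ⟦ e ⟧ s ≢ 0 →
              Run B P s k s′ → Run B (ifnz e P Q) s (suc (size e + k)) s′

  run-else  : ∀ {e P Q s s′ k} → NoOverflow B e s → ⟦ e ⟧ s ≡ 0 →
              Run B Q s k s′ → Run B (ifnz e P Q) s (suc (size e + k)) s′

  run-loop  : ∀ {e P s s′ s″ k l} → NoOverflow B e s → ⟦ e ⟧ s ≢ 0 →
              Run B P s k s′ → Run B (while e P) s′ l s″ →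
              Run B (while e P) s (suc (size e + (k + l))) s″

  run-exit  : ∀ {e P s} → NoOverflow B e s → ⟦ e ⟧ s ≡ 0 →
              Run B (while e P) s (suc (size e)) s

bits : ∀ {t} → Vec Bool t → ℕ → ℕ
bits []          _       = 0
bits (b ∷ bs)    zero    = if b then 1 else 0
bits (b ∷ bs)    (suc i) = bits bs i

-- Input: n in register 0, t in register 1, and the outcome of test i at
-- address i; everything else is 0.
initial : ∀ {t} → ℕ → Vec Bool t → State
initial {t} n outcomes = ⟨ ((λ _ → 0) [ 0 ↦ n ]) [ 1 ↦ t ] , bits outcomes ⟩

-- Output: the number of items in S at address 0, then their column numbers
-- (counted from 0, in any order) at addresses 1, …, ∣ S ∣.
Outputs : ∀ {n} → State → Subset n → Set
Outputs s S = mem s 0 ≡ ∣ S ∣ ×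
              (∀ j → j ∈ S ⇔ (∃[ i ] i < ∣ S ∣ × mem s (suc i) ≡ toℕ j))

-- P identifies every set of at most d defective items in at most c * t steps,
-- using words with values at most (n + t) ^ w.
Analyses : ∀ {t n} → (d c w : ℕ) → Program → Matrix t n → Set
Analyses {t} {n} d c w P M =
  ∀ S → ∣ S ∣ ≤ d →
  ∃[ k ] ∃[ s ] Run ((n + t) ^ w) P (initial n (booleanSum M S)) k s ×
                k ≤ c * t × Outputs s S

-- One program, with one constant in the O(t) bound and words of O(log (n + t))
-- bits, serves the whole family.
TimeOptimal : {I : Set} {t n : I → ℕ} → ℕ → (∀ i → Matrix (t i) (n i)) → Set
TimeOptimal d M =
  Σ[ P ∈ Program ] ∃[ c ] ∃[ w ] (∀ i → Analyses d c w P (M i))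

{-# OPTIONS --safe #-}

-- For all positions i < p and all bits b, v, a test takes the items whose binary
-- expansion has bit i equal to b and bit p equal to v: 4 (q choose 2) = 2q² - 2q tests.
-- A word is consistent with a positive outcome of all its tests precisely when every two
-- of its bits occur together in some defective.  With at most three defectives a, b, c,
-- such a word is a, b, c or their bitwise median: a word differing from all four differs
-- from two of them at one position and from the third at another, and no defective matches
-- it at both.  The same holds for the prefixes of length p, so extending the consistent
-- prefixes bit by bit keeps at most four of them and takes O(p) steps for bit p, hence
-- O(q²) in total.  If four words remain, they are distinct, so the median is not a
-- defective; it is the bitwise majority "at least three of four" of the four words and is
-- removed.  Separability follows, since the decoder is deterministic and determines the
-- defectives from the outcomes.

module Submission where

open import Data.Bool.Base using (Bool; true; false; if_then_else_; _∧_; _∨_)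
open import Data.Bool.ListAction using (any)
open import Data.Bool.Properties using (∧-assoc; ∧-identityʳ) renaming (_≟_ to _≟ᵇ_)
open import Data.Fin.Base as Fin using (Fin; toℕ)
open import Data.Fin.Properties using (toℕ-injective; toℕ<n) renaming (suc-injective to fsuc-injective)
open import Data.Fin.Subset using (Subset; ∣_∣; inside; outside) renaming (_∈_ to _∈ˢ_)
open import Data.Fin.Subset.Properties using (drop-there; ⊆-antisym)
open import Data.List.Base using (List; []; _∷_; _++_; length; map; filter)
import Data.List.Membership.DecPropositional as DecMembership
open import Data.List.Membership.Propositional using (_∈_; _∉_)
open import Data.List.Membership.Propositional.Properties
  using (∈-∃++; ∈-++⁺ˡ; ∈-++⁺ʳ; ∈-++⁻; ∈-filter⁺; ∈-filter⁻; ∈-map⁺; ∈-map⁻)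
open import Data.List.Properties
  using (++-identityʳ; filter-accept; filter-reject; length-++; length-map; map-cong; map-∘)
open import Data.List.Relation.Binary.Permutation.Propositional
  using (_↭_; ↭-sym; ↭-trans; ↭-prep; ↭-refl; ↭⇒↭ₛ)
open import Data.List.Relation.Binary.Permutation.Propositional.Properties
  using (shift; ↭-length) renaming (map⁺ to ↭-map⁺)
open import Data.List.Relation.Binary.Permutation.Setoid.Properties using (Unique-resp-↭)
open import Data.List.Relation.Binary.Subset.Propositional using (_⊆_)
open import Data.List.Relation.Binary.Subset.Propositional.Properties using () renaming (map⁺ to ⊆-map⁺)
open import Data.List.Relation.Unary.All using ([]; _∷_)
open import Data.List.Relation.Unary.All.Properties using (¬Any⇒All¬)
open import Data.List.Relation.Unary.AllPairs using ([]; _∷_)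
open import Data.List.Relation.Unary.Any using (here; there)
open import Data.List.Relation.Unary.Unique.Propositional using (Unique)
open import Data.List.Relation.Unary.Unique.Propositional.Properties
  using (Unique[x∷xs]⇒x∉xs) renaming (filter⁺ to unique-filter⁺; map⁺ to unique-map⁺; map⁻ to unique-map⁻)
open import Data.Nat.Base
open import Data.Nat.ListAction.Properties using (sum-↭)
open import Data.Nat.Properties
open import Data.Nat.Tactic.RingSolver using (solve-∀)
open import Data.Product.Base using (Σ-syntax; ∃; ∃-syntax; _×_; _,_; proj₁; proj₂)
open import Data.Sum.Base using (_⊎_; inj₁; inj₂; [_,_]′)
open import Data.Unit.Base using (tt)
open import Data.Vec.Base as Vec using (Vec; []; _∷_; tabulate; zipWith; foldr′)
open import Data.Vec.Properties using (≡-dec)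
open import Function.Bundles using (_⇔_; mk⇔; Equivalence)
open import Relation.Binary.Definitions using (tri<; tri≈; tri>)
open import Relation.Binary.PropositionalEquality
open import Relation.Nullary.Decidable using (Dec; does; yes; no; ¬?)
open import Relation.Nullary.Negation using (contradiction)
open import Defs

-- Running programs

-- Without shifts and bitwise operations, the bits of a word can be reached only from the top: the
-- remaining bits are kept scaled, so that doubling lifts the next one to the weight `2 ^ p`, where
-- a comparison reads it and a subtraction removes it. This fixes the descending order of positions
-- inside a block of tests: one address register then runs through block `p` in step with the bits.
-- Since at most four words survive, they fit in registers, and each of them costs a constant per
-- position, hence per test. The argument separates the machine from the combinatorics. For an
-- arbitrary outcome function, the program is shown to compute the list functions `sweep`,
-- `candidates`, `vote` and `results` within a step bound, as long as no list exceeds four words;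
-- only afterwards are these lists related to the defectives. Prefixes of length one meet no test,
-- so both are kept unconditionally; confinement to the defectives and their median starts at length
-- two, where every position has a partner.

module _ where

  private variable
    B c d k k′ : ℕ
    P Q : Program
    e f : Expr
    s s′ s″ : State

  run-deterministic : Run B P s k s′ → Run B P s k′ s″ → s′ ≡ s″
  run-deterministic run-skip run-skip = refl
  run-deterministic (run-≔ _) (run-≔ _) = refl
  run-deterministic (run-store _ _) (run-store _ _) = refl
  run-deterministic (run-⨾ p q) (run-⨾ p′ q′)
    with refl ← run-deterministic p p′ = run-deterministic q q′
  run-deterministic (run-then _ _ p) (run-then _ _ p′) = run-deterministic p p′
  run-deterministic (run-then _ e≢0 _) (run-else _ e≡0 _) = contradiction e≡0 e≢0
  run-deterministic (run-else _ e≡0 _) (run-then _ e≢0 _) = contradiction e≡0 e≢0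
  run-deterministic (run-else _ _ p) (run-else _ _ p′) = run-deterministic p p′
  run-deterministic (run-loop _ _ p q) (run-loop _ _ p′ q′)
    with refl ← run-deterministic p p′ = run-deterministic q q′
  run-deterministic (run-loop _ e≢0 _ _) (run-exit _ e≡0) = contradiction e≡0 e≢0
  run-deterministic (run-exit _ e≡0) (run-loop _ e≢0 _ _) = contradiction e≡0 e≢0
  run-deterministic (run-exit _ _) (run-exit _ _) = refl

  -- Configurations list the registers; those beyond the end of the list are 0.
  Config : Set
  Config = List ℕ × (ℕ → ℕ)

  nth : List ℕ → ℕ → ℕ
  nth []      _       = 0
  nth (x ∷ _) zero    = x
  nth (_ ∷ l) (suc i) = nth l i

  upd : List ℕ → Reg → ℕ → List ℕ
  upd []      zero    v = v ∷ []
  upd []      (suc r) v = 0 ∷ upd [] r v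
  upd (_ ∷ l) zero    v = v ∷ l
  upd (x ∷ l) (suc r) v = x ∷ upd l r v

  nth-upd : ∀ l r v → (nth l) [ r ↦ v ] ≗ nth (upd l r v)
  nth-upd []      zero    v zero    = refl
  nth-upd []      zero    v (suc i) = refl
  nth-upd []      (suc r) v zero    = refl
  nth-upd []      (suc r) v (suc i) = nth-upd [] r v i
  nth-upd (x ∷ l) zero    v zero    = refl
  nth-upd (x ∷ l) zero    v (suc i) = refl
  nth-upd (x ∷ l) (suc r) v zero    = refl
  nth-upd (x ∷ l) (suc r) v (suc i) = nth-upd l r v i

  private variable
    l l′ : List ℕ
    μ μ′ ρ ρ′ : ℕ → ℕ
    σ σ′ σ″ : Config

  state : Config → State
  state (l , μ) = ⟨ nth l , μ ⟩

  [↦]-cong : ∀ r {v w} → ρ ≗ ρ′ → v ≡ w → ρ [ r ↦ v ] ≗ ρ′ [ r ↦ w ]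
  [↦]-cong r eq refl i with r ≡ᵇ i
  ... | true  = refl
  ... | false = eq i

  ↦-same : ∀ (f : ℕ → ℕ) a v → (f [ a ↦ v ]) a ≡ v
  ↦-same f zero    v = refl
  ↦-same f (suc a) v = ↦-same (λ i → f (suc i)) a v

  ↦-other : ∀ (f : ℕ → ℕ) a v {b} → a ≢ b → (f [ a ↦ v ]) b ≡ f b
  ↦-other f zero    v {zero}  a≢b = contradiction refl a≢b
  ↦-other f zero    v {suc b} a≢b = refl
  ↦-other f (suc a) v {zero}  a≢b = refl
  ↦-other f (suc a) v {suc b} a≢b = ↦-other (λ i → f (suc i)) a v (λ eq → a≢b (cong suc eq))

  ⟦⟧-cong : ∀ e → ρ ≗ ρ′ → ⟦ e ⟧ ⟨ ρ , μ ⟩ ≡ ⟦ e ⟧ ⟨ ρ′ , μ ⟩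
  ⟦⟧-cong (lit k)  eq = refl
  ⟦⟧-cong (get r)  eq = eq r
  ⟦⟧-cong {μ = μ} (load e) eq = cong μ (⟦⟧-cong e eq)
  ⟦⟧-cong (e ⊕ f)  eq = cong₂ _+_ (⟦⟧-cong e eq) (⟦⟧-cong f eq)
  ⟦⟧-cong (e ⊖ f)  eq = cong₂ _∸_ (⟦⟧-cong e eq) (⟦⟧-cong f eq)

  NoOverflow-resp : ∀ e → ρ ≗ ρ′ → NoOverflow B e ⟨ ρ′ , μ ⟩ → NoOverflow B e ⟨ ρ , μ ⟩
  NoOverflow-resp (lit k)  eq p = p
  NoOverflow-resp (get r)  eq p = p
  NoOverflow-resp (load e) eq p = NoOverflow-resp e eq p
  NoOverflow-resp {B = B} (e ⊕ f)  eq (p , q , b) =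
    NoOverflow-resp e eq p , NoOverflow-resp f eq q ,
    subst (_≤ B) (sym (⟦⟧-cong (e ⊕ f) eq)) b
  NoOverflow-resp (e ⊖ f)  eq (p , q) = NoOverflow-resp e eq p , NoOverflow-resp f eq q

  -- Registers are compared pointwise, for want of function extensionality.
  record Exec (B : ℕ) (P : Program) (σ : Config) (c : ℕ) (σ′ : Config) : Set where
    field
      run : ∀ {ρ} → ρ ≗ nth (proj₁ σ) →
            ∃[ k ] ∃[ ρ′ ] Run B P ⟨ ρ , proj₂ σ ⟩ k ⟨ ρ′ , proj₂ σ′ ⟩ ×
                           k ≤ c × ρ′ ≗ nth (proj₁ σ′)

  open Exec

  exec-skip : Exec B skip σ 0 σ
  exec-skip .run eq = _ , _ , run-skip , ≤-refl , eq

  exec-≔ : ∀ {r v} → NoOverflow B e (state (l , μ)) → ⟦ e ⟧ (state (l , μ)) ≡ v →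
           Exec B (r ≔ e) (l , μ) (suc (size e)) (upd l r v , μ)
  exec-≔ {e = e} {l = l} {r = r} p v≡ .run eq =
    _ , _ , run-≔ (NoOverflow-resp e eq p) , ≤-refl ,
    λ i → trans ([↦]-cong r eq (trans (⟦⟧-cong e eq) v≡) i) (nth-upd l r _ i)

  exec-store : ∀ {a v} → NoOverflow B e (state (l , μ)) → NoOverflow B f (state (l , μ)) →
               ⟦ e ⟧ (state (l , μ)) ≡ a → ⟦ f ⟧ (state (l , μ)) ≡ v →
               Exec B (store e f) (l , μ) (suc (size e + size f)) (l , μ [ a ↦ v ])
  exec-store {e = e} {f = f} p q a≡ v≡ .run eq
    with refl ← trans (⟦⟧-cong e eq) a≡ | refl ← trans (⟦⟧-cong f eq) v≡ =
    _ , _ , run-store (NoOverflow-resp e eq p) (NoOverflow-resp f eq q) , ≤-refl , eq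

  infixr 4 _⨾ᵉ_
  _⨾ᵉ_ : Exec B P σ c σ′ → Exec B Q σ′ d σ″ → Exec B (P ⨾ Q) σ (c + d) σ″
  (x ⨾ᵉ y) .run eq with x .run eq
  ... | _ , _ , p , k≤ , eq′ with y .run eq′
  ... | _ , _ , q , l≤ , eq″ = _ , _ , run-⨾ p q , +-mono-≤ k≤ l≤ , eq″

  exec-then : NoOverflow B e (state σ) → ⟦ e ⟧ (state σ) ≢ 0 →
              Exec B P σ c σ′ → Exec B (ifnz e P Q) σ (suc (size e + c)) σ′
  exec-then {e = e} p nz x .run eq with x .run eq
  ... | _ , _ , q , k≤ , eq′ =
    _ , _ , run-then (NoOverflow-resp e eq p) (λ z → nz (trans (sym (⟦⟧-cong e eq)) z)) q ,
    +-monoʳ-≤ (suc (size e)) k≤ , eq′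

  exec-else : NoOverflow B e (state σ) → ⟦ e ⟧ (state σ) ≡ 0 →
              Exec B Q σ c σ′ → Exec B (ifnz e P Q) σ (suc (size e + c)) σ′
  exec-else {e = e} p z x .run eq with x .run eq
  ... | _ , _ , q , k≤ , eq′ =
    _ , _ , run-else (NoOverflow-resp e eq p) (trans (⟦⟧-cong e eq) z) q ,
    +-monoʳ-≤ (suc (size e)) k≤ , eq′

  exec-loop : NoOverflow B e (state σ) → ⟦ e ⟧ (state σ) ≢ 0 →
              Exec B P σ c σ′ → Exec B (while e P) σ′ d σ″ →
              Exec B (while e P) σ (suc (size e + (c + d))) σ″
  exec-loop {e = e} p nz x y .run eq with x .run eq
  ... | _ , _ , q , k≤ , eq′ with y .run eq′
  ... | _ , _ , r , l≤ , eq″ =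
    _ , _ , run-loop (NoOverflow-resp e eq p) (λ z → nz (trans (sym (⟦⟧-cong e eq)) z)) q r ,
    +-monoʳ-≤ (suc (size e)) (+-mono-≤ k≤ l≤) , eq″

  exec-exit : NoOverflow B e (state σ) → ⟦ e ⟧ (state σ) ≡ 0 →
              Exec B (while e P) σ (suc (size e)) σ
  exec-exit {e = e} p z .run eq =
    _ , _ , run-exit (NoOverflow-resp e eq p) (trans (⟦⟧-cong e eq) z) , ≤-refl , eq

  exec-≤ : c ≤ d → Exec B P σ c σ′ → Exec B P σ d σ′
  exec-≤ c≤d x .run eq with x .run eq
  ... | _ , _ , p , k≤ , eq′ = _ , _ , p , ≤-trans k≤ c≤d , eq′

-- Binary words, prefix search and the order of the tests

b2n : Bool → ℕ
b2n b = if b then 1 else 0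

val : ∀ {p} → Vec Bool p → ℕ
val []              = 0
val (_∷_ {p} b w) = b2n b * 2 ^ p + val w

val<2^ : ∀ {p} (w : Vec Bool p) → val w < 2 ^ p
val<2^ []          = s≤s z≤n
val<2^ {suc p} (true ∷ w)  = begin-strict
  (2 ^ p + 0) + val w <⟨ +-monoʳ-< (2 ^ p + 0) (val<2^ w) ⟩
  (2 ^ p + 0) + 2 ^ p ≡⟨ +-comm (2 ^ p + 0) (2 ^ p) ⟩
  2 ^ suc p           ∎
  where open ≤-Reasoning
val<2^ (false ∷ w) = ≤-trans (val<2^ w) (m≤m+n _ _)

scaled-val< : ∀ c {p n} (w : Vec Bool p) → c * 2 ^ p ≡ n → 0 < n → c * val w < n
scaled-val< zero    w refl ()
scaled-val< (suc c) w refl _ = *-monoʳ-< (suc c) (val<2^ w)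

-- Tests are named by (p , i , b , v) with i < p: the items with bit i equal to b
-- and bit p equal to v.
Test : Set
Test = ℕ × ℕ × Bool × Bool

module _ (outcome : Test → Bool) where

  extends : ∀ {m} → ℕ → Bool → Vec Bool m → Bool
  extends p v []            = true
  extends p v (_∷_ {m} b w) = outcome (p , m , b , v) ∧ extends p v w

  pushIf : ∀ {A : Set} → Bool → A → List A → List A
  pushIf b x xs = if b then x ∷ xs else xs

  sweep : ∀ {p} → List (Vec Bool p) → List (Vec Bool (suc p)) → List (Vec Bool (suc p))
  sweep         []       acc = acc
  sweep {p} (w ∷ ws) acc =
    sweep ws (pushIf (extends p true w) (true ∷ w) (pushIf (extends p false w) (false ∷ w) acc))

  candidates : ∀ p → List (Vec Bool (suc p))
  candidates zero    = (false ∷ []) ∷ (true ∷ []) ∷ []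
  candidates (suc p) = sweep (candidates p) []

-- Slot i of a list of words held in registers: a word is stored as its value plus one,
-- and 0 marks an empty slot.
code : ∀ {p} → List (Vec Bool p) → ℕ → ℕ
code []       _       = 0
code (w ∷ _)  zero    = suc (val w)
code (_ ∷ ws) (suc i) = code ws i

code-beyond : ∀ {p} (ws : List (Vec Bool p)) {i} → length ws ≤ i → code ws i ≡ 0
code-beyond []       _         = refl
code-beyond (_ ∷ ws) (s≤s len) = code-beyond ws len

-- The address order of the tests.  Block p lists the positions i = p - 1, …, 0 downwards,
-- in the order in which doubling brings up the bits of a word; `locate r p i` lies r
-- addresses after the first of the four tests for (p , i).
locate : ℕ → ℕ → ℕ → Test
locate 0 p i = p , i , false , false
locate 1 p i = p , i , false , true
locate 2 p i = p , i , true  , false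
locate 3 p i = p , i , true  , true
locate (suc (suc (suc (suc r)))) p zero    = locate r (suc p) p
locate (suc (suc (suc (suc r)))) p (suc i) = locate r p i

test : ℕ → Test
test r = locate r 1 0

-- Blocks 1, …, p - 1 take up the first blocks p addresses.
blocks : ℕ → ℕ
blocks zero    = 0
blocks (suc p) = blocks p + p * 4

-- The decoder

-- Registers in the main loop, for words of length p:
--   0  n               2  2 ^ p          3, 4  start and end of block p
--   5  length of block p                 6-9   words of length p not yet extended
--   10-13  words of length p + 1         14    code of the word being extended
--   15  its remaining bits, scaled so that doubling compares the next one with 2 ^ p
--   16  current address                  17, 18  whether it extends by 0, by 1
-- In `median`, 3 sums the bits of the four words at one position, 5 is four times the number
-- of positions left, 14 collects the median and 15-18 hold the scaled words.  From then on,
-- 14 is the code of the word to drop (0 for none) and 13 counts the words written.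

push : Expr → Program
push e = 13 ≔ get 12 ⨾ 12 ≔ get 11 ⨾ 11 ≔ get 10 ⨾ 10 ≔ e

pop : Program
pop = 6 ≔ get 7 ⨾ 7 ≔ get 8 ⨾ 8 ≔ get 9 ⨾ 9 ≔ lit 0

-- Conjunction of truth values 0 and 1.
meet : Reg → Expr → Program
meet r e = r ≔ get r ⊕ load e ⊖ lit 1

check : Program
check =
  15 ≔ get 15 ⊕ get 15 ⨾
  ifnz (lit 1 ⊕ get 15 ⊖ get 2)
    (15 ≔ get 15 ⊖ get 2 ⨾ meet 17 (get 16 ⊕ lit 2) ⨾ meet 18 (get 16 ⊕ lit 3))
    (meet 17 (get 16) ⨾ meet 18 (get 16 ⊕ lit 1)) ⨾
  16 ≔ get 16 ⊕ lit 4

prepare : Program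
prepare = 14 ≔ get 6 ⨾ pop ⨾ 15 ≔ get 14 ⊖ lit 1 ⨾ 16 ≔ get 3 ⨾ 17 ≔ lit 1 ⨾ 18 ≔ lit 1

try : Program
try =
  prepare ⨾
  while (get 4 ⊖ get 16) check ⨾
  ifnz (get 17) (push (get 14)) skip ⨾
  ifnz (get 18) (push (get 14 ⊕ get 2)) skip

level : Program
level =
  while (get 6) try ⨾
  6 ≔ get 10 ⨾ 7 ≔ get 11 ⨾ 8 ≔ get 12 ⨾ 9 ≔ get 13 ⨾
  10 ≔ lit 0 ⨾ 11 ≔ lit 0 ⨾ 12 ≔ lit 0 ⨾ 13 ≔ lit 0 ⨾
  2 ≔ get 2 ⊕ get 2 ⨾ 5 ≔ get 5 ⊕ lit 4 ⨾ 3 ≔ get 4 ⨾ 4 ≔ get 4 ⊕ get 5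

peel : Reg → Program
peel r =
  4 ≔ lit 1 ⊖ (get 0 ⊖ (get r ⊕ get r)) ⨾ r ≔ get r ⊕ get r ⊖ load (get 4) ⨾ 3 ≔ get 3 ⊕ get 4

-- The subtraction computes whether at least three of the four bits are 1.
round : Program
round =
  3 ≔ lit 0 ⨾ peel 15 ⨾ peel 16 ⨾ peel 17 ⨾ peel 18 ⨾
  14 ≔ get 14 ⊕ get 14 ⊕ (lit 1 ⊖ (lit 3 ⊖ get 3)) ⨾ 5 ≔ get 5 ⊖ lit 4

-- Addresses 0 and 1 become the table b ↦ b * n used by `peel`; the outcomes are no longer
-- needed.
median : Program
median =
  store (lit 0) (lit 0) ⨾ store (lit 1) (get 0) ⨾
  15 ≔ get 6 ⊖ lit 1 ⨾ 16 ≔ get 7 ⊖ lit 1 ⨾ 17 ≔ get 8 ⊖ lit 1 ⨾ 18 ≔ get 9 ⊖ lit 1 ⨾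
  while (get 5) round ⨾ 14 ≔ get 14 ⊕ lit 1

emit : Program
emit =
  ifnz ((get 6 ⊖ get 14) ⊕ (get 14 ⊖ get 6))
    (13 ≔ get 13 ⊕ lit 1 ⨾ store (get 13) (get 6 ⊖ lit 1)) skip ⨾
  pop

-- Sets up length one: the words 0 and 1 have codes 1 and 2, and block 1 occupies the addresses 0 to
-- 3. Writing 0 to register 18 leaves its value alone but pads the register list of the
-- configuration to its full length, so that it matches `sweeping` by computation.
start : Program
start = 18 ≔ lit 0 ⨾ 2 ≔ lit 2 ⨾ 4 ≔ lit 4 ⨾ 5 ≔ lit 4 ⨾ 6 ≔ lit 1 ⨾ 7 ≔ lit 2

output : Program
output =
  14 ≔ lit 0 ⨾ ifnz (get 9) median skip ⨾
  while (get 6) emit ⨾ store (lit 0) (get 13)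

decoder : Program
decoder = start ⨾ while (get 0 ⊖ get 2) level ⨾ output

-- Correctness and cost of the prefix search

∸≢0 : ∀ {m n} → n < m → m ∸ n ≢ 0
∸≢0 n<m eq = <⇒≱ n<m (m∸n≡0⇒m≤n eq)

-- Every overflow check of the decoder reduces to a sum of two terms of this size, where `N` is
-- finally the number of items plus the number of tests.
sum≤ : ∀ {N B a b} → 8 * N ≤ B → a ≤ 2 * N → b ≤ 2 * N → a + b ≤ B
sum≤ {N} {B} {a} {b} N≤ a≤ b≤ = begin
  a + b         ≤⟨ +-mono-≤ a≤ b≤ ⟩
  2 * N + 2 * N ≡⟨ eq N ⟩
  4 * N         ≤⟨ *-monoˡ-≤ N (m≤m+n 4 4) ⟩
  8 * N         ≤⟨ N≤ ⟩
  B             ∎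
  where
  open ≤-Reasoning
  eq : ∀ N → 2 * N + 2 * N ≡ 4 * N
  eq = solve-∀

Points : ℕ → ℕ → ℕ → Set
Points a p i = ∀ r → test (a + r) ≡ locate r p i

Points-next : ∀ {a p i} → Points a p (suc i) → Points (a + 4) p i
Points-next {a} at r = trans (cong test (+-assoc a 4 r)) (at (4 + r))

Points-end : ∀ {a p} → Points a p 0 → Points (a + 4) (suc p) p
Points-end {a} at r = trans (cong test (+-assoc a 4 r)) (at (4 + r))

-- The address a is m groups of four tests away from the end of block p.
At : ℕ → ℕ → ℕ → Set
At a p zero    = Points a (suc p) p
At a p (suc i) = Points a p i

At-next : ∀ {a p} i → At a p (suc i) → At (a + 4) p i
At-next {a} zero    = Points-end {a}
At-next {a} (suc i) = Points-next {a}

At-block : ∀ {a p} m → At a p m → At (a + m * 4) p 0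
At-block {a} {p} zero    at = subst (λ x → At x p 0) (sym (+-identityʳ a)) at
At-block {a} {p} (suc m) at =
  subst (λ x → At x p 0) (+-assoc a 4 (m * 4)) (At-block m (At-next {a} m at))

At-blocks : ∀ p → At (blocks (suc p)) (suc p) (suc p)
At-blocks zero    = λ r → refl
At-blocks (suc p) = At-block {blocks (suc p)} (suc p) (At-blocks p)

-- Registers 14 to 18. What one word leaves there is irrelevant to the next, so results quantify
-- over it existentially.
Scratch : Set
Scratch = ℕ × ℕ × ℕ × ℕ × ℕ

sweeping : ∀ {p} → (n τ base next len : ℕ) → List (Vec Bool p) → List (Vec Bool (suc p)) → Scratch → List ℕ
sweeping {p} n τ base next len ws acc (x , r , a , o₀ , o₁) =
  n ∷ τ ∷ 2 ^ p ∷ base ∷ next ∷ len ∷ code ws 0 ∷ code ws 1 ∷ code ws 2 ∷ code ws 3 ∷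
  code acc 0 ∷ code acc 1 ∷ code acc 2 ∷ code acc 3 ∷ x ∷ r ∷ a ∷ o₀ ∷ o₁ ∷ []

blocks-mono : ∀ {m n} → m ≤ n → blocks m ≤ blocks n
blocks-mono {n = zero} z≤n = z≤n
blocks-mono {m} {suc n} m≤n with m≤n⇒m<n∨m≡n m≤n
... | inj₁ (s≤s m<n) = ≤-trans (blocks-mono m<n) (m≤m+n _ _)
... | inj₂ refl = ≤-refl

-- Charges a level, including its loop test, to the `suc p * 4` tests of its block: at most 228 +
-- 160 = 388 steps per position, which is 97 per test.
step-cost : ∀ p → 4 + (224 + suc p * 160) ≤ suc p * 4 * 97
step-cost p = begin
  228 + suc p * 160         ≤⟨ +-monoˡ-≤ (suc p * 160) (m≤n*m 228 (suc p)) ⟩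
  suc p * 228 + suc p * 160 ≡⟨ *-distribˡ-+ (suc p) 228 160 ⟨
  suc p * 388               ≡⟨ *-assoc (suc p) 4 97 ⟨
  suc p * 4 * 97            ∎
  where open ≤-Reasoning

regroup : ∀ y c b → y + c + b ≡ c + (b + y)
regroup = solve-∀

module _ (outcome : Test → Bool) (μ : ℕ → ℕ) (t N B : ℕ)
         (reads : ∀ r → r < t → μ r ≡ b2n (outcome (test r)))
         (8N≤B : 8 * N ≤ B) (4≤N : 4 ≤ N) (t≤N : t ≤ N) where

  private
    add≤ : ∀ {a b} → a ≤ 2 * N → b ≤ 2 * N → a + b ≤ B
    add≤ = sum≤ {N} 8N≤B

    lit≤ : ∀ {a} → a ≤ 4 → a ≤ 2 * N
    lit≤ a≤ = ≤-trans a≤ (≤-trans 4≤N (m≤m+n N _))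

    bit≤ : ∀ b → b2n b ≤ 2 * N
    bit≤ false = z≤n
    bit≤ true  = lit≤ (s≤s z≤n)

    meet-bits : ∀ a b → b2n a + b2n b ∸ 1 ≡ b2n (a ∧ b)
    meet-bits false false = refl
    meet-bits false true  = refl
    meet-bits true  b     = refl

  exec-meet : ∀ {l r e a b} → NoOverflow B e (state (l , μ)) →
              ⟦ get r ⟧ (state (l , μ)) ≡ b2n a →
              ⟦ load e ⟧ (state (l , μ)) ≡ b2n b →
              Exec B (meet r e) (l , μ) (size e + 6) (upd l r (b2n (a ∧ b)) , μ)
  exec-meet {e = e} {a} {b} p a≡ b≡ = exec-≤ (≤-reflexive (eq (size e))) (exec-≔
    ((tt , p , subst₂ (λ x y → x + y ≤ B) (sym a≡) (sym b≡) (add≤ (bit≤ a) (bit≤ b))) , tt)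
    (trans (cong₂ (λ x y → x + y ∸ 1) a≡ b≡) (meet-bits a b)))
    where
    eq : ∀ s → suc (suc (suc (suc (suc s)) + 1)) ≡ s + 6
    eq = solve-∀

  read-at : ∀ {a p i} r → Points a p i → a + r < t → μ (a + r) ≡ b2n (outcome (locate r p i))
  read-at r at a+r<t = trans (reads _ a+r<t) (cong (λ q → b2n (outcome q)) (at r))

  module _ (n τ base next len k₀ k₁ k₂ k₃ j₀ j₁ j₂ j₃ x p : ℕ)
           (2^p≤N : 2 ^ p ≤ N) where

    checking : ℕ → ℕ → Bool → Bool → Config
    checking r a o₀ o₁ =
      n ∷ τ ∷ 2 ^ p ∷ base ∷ next ∷ len ∷ k₀ ∷ k₁ ∷ k₂ ∷ k₃ ∷ j₀ ∷ j₁ ∷ j₂ ∷ j₃ ∷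
      x ∷ r ∷ a ∷ b2n o₀ ∷ b2n o₁ ∷ [] , μ

    -- By the scaling hypothesis the doubled register is `b * 2 ^ p` plus a remainder below `2 ^ p`.
    -- The comparison therefore branches on `b`, and the remainder is again the value of the
    -- remaining bits, at twice the scale.
    exec-check : ∀ {m} {w : Vec Bool m} b {h a o₀ o₁} → 2 * h * 2 ^ m ≡ 2 ^ p →
                 Points a p m → a + 3 < t →
                 Exec B check (checking (h * val (b ∷ w)) a o₀ o₁) 36
                              (checking (2 * h * val w) (a + 4)
                                (o₀ ∧ outcome (p , m , b , false)) (o₁ ∧ outcome (p , m , b , true)))
    exec-check {m} {w} b {h} {a} scale at a+3<t = body b
      where
      s : ℕ
      s = 2 * h * val w

      s<2^p : s < 2 ^ p
      s<2^p = scaled-val< (2 * h) w scale (m^n>0 2 p)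

      double : ∀ b → h * val (b ∷ w) + h * val (b ∷ w) ≡ b2n b * 2 ^ p + s
      double b = trans (eq h (b2n b) (2 ^ m) (val w)) (cong (λ z → b2n b * z + s) scale)
        where
        eq : ∀ h b q v → h * (b * q + v) + h * (b * q + v) ≡ b * (2 * h * q) + 2 * h * v
        eq = solve-∀

      addr≤ : ∀ r → r ≤ 3 → a + r ≤ 2 * N
      addr≤ r r≤3 = ≤-trans (≤-trans (+-monoʳ-≤ a r≤3) (<⇒≤ a+3<t)) (≤-trans t≤N (m≤m+n N _))

      a≤ : a ≤ 2 * N
      a≤ = ≤-trans (m≤m+n a 0) (addr≤ 0 z≤n)

      sum≤2N : ∀ b → b2n b * 2 ^ p + s ≤ 2 * N
      sum≤2N false = ≤-trans (<⇒≤ s<2^p) (≤-trans 2^p≤N (m≤m+n N _))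
      sum≤2N true  = +-mono-≤ (≤-trans (≤-reflexive (+-identityʳ _)) 2^p≤N)
                              (≤-trans (<⇒≤ s<2^p) (≤-trans 2^p≤N (m≤m+n N 0)))

      r≤ : ∀ b → h * val (b ∷ w) ≤ 2 * N
      r≤ b = ≤-trans (m≤m+n _ (h * val (b ∷ w))) (≤-trans (≤-reflexive (double b)) (sum≤2N b))

      reading : ∀ r → r ≤ 3 → μ (a + r) ≡ b2n (outcome (locate r p m))
      reading r r≤3 = read-at r at (≤-<-trans (+-monoʳ-≤ a r≤3) a+3<t)

      body : ∀ b {o₀ o₁} →
             Exec B check (checking (h * val (b ∷ w)) a o₀ o₁) 36
                          (checking s (a + 4)
                            (o₀ ∧ outcome (p , m , b , false)) (o₁ ∧ outcome (p , m , b , true)))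
      body true =
        exec-≔ (tt , tt , add≤ (r≤ true) (r≤ true)) (double true) ⨾ᵉ
        exec-then ((tt , tt , add≤ (lit≤ (s≤s z≤n)) (sum≤2N true)) , tt)
          (∸≢0 {n = 2 ^ p} (s≤s (≤-trans (m≤m+n _ 0) (m≤m+n _ s))))
          (exec-≔ (tt , tt) (trans (cong (λ z → z + s ∸ 2 ^ p) (+-identityʳ (2 ^ p))) (m+n∸m≡n (2 ^ p) s)) ⨾ᵉ
           exec-meet (tt , tt , add≤ a≤ (lit≤ (s≤s (s≤s z≤n)))) refl (reading 2 (s≤s (s≤s z≤n))) ⨾ᵉ
           exec-meet (tt , tt , add≤ a≤ (lit≤ (s≤s (s≤s (s≤s z≤n))))) refl (reading 3 ≤-refl)) ⨾ᵉ
        exec-≔ (tt , tt , add≤ a≤ (lit≤ ≤-refl)) refl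
      body false =
        exec-≔ (tt , tt , add≤ (r≤ false) (r≤ false)) (double false) ⨾ᵉ
        exec-else ((tt , tt , add≤ (lit≤ (s≤s z≤n)) (sum≤2N false)) , tt)
          (m≤n⇒m∸n≡0 s<2^p)
          (exec-≤ (m≤m+n 16 6)
          (exec-meet tt refl (trans (cong μ (sym (+-identityʳ a))) (reading 0 z≤n)) ⨾ᵉ
           exec-meet (tt , tt , add≤ a≤ (lit≤ (s≤s z≤n))) refl (reading 1 (s≤s z≤n)))) ⨾ᵉ
        exec-≔ (tt , tt , add≤ a≤ (lit≤ ≤-refl)) refl

    exec-checks : ∀ {m} (w : Vec Bool m) {h a o₀ o₁} → h * 2 ^ m ≡ 2 ^ p →
                  At a p m → a + m * 4 ≡ next → next ≤ t →
                  Exec B (while (get 4 ⊖ get 16) check) (checking (h * val w) a o₀ o₁) (4 + m * 40)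
                         (checking 0 next (o₀ ∧ extends outcome p false w) (o₁ ∧ extends outcome p true w))
    exec-checks [] {h} {a} {o₀} {o₁} scale at a≡next next≤t
      rewrite ∧-identityʳ o₀ | ∧-identityʳ o₁ | *-zeroʳ h | trans (sym (+-identityʳ a)) a≡next =
      exec-exit (tt , tt) (n∸n≡0 next)
    exec-checks {suc m} (b ∷ w) {h} {a} {o₀} {o₁} scale at a≡next next≤t =
      subst₂ (λ x y → Exec B (while (get 4 ⊖ get 16) check) (checking (h * val (b ∷ w)) a o₀ o₁)
                             (4 + suc m * 40) (checking 0 next x y))
             (∧-assoc o₀ _ _) (∧-assoc o₁ _ _)
             (exec-≤ (≤-reflexive (cost m))
               (exec-loop (tt , tt) (∸≢0 a<next)
                 (exec-check {w = w} b {h} scale′ at (<-≤-trans (+-monoʳ-< a (n<1+n 3)) (≤-trans a+4≤next next≤t)))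
                 (exec-checks w {2 * h} scale′ (At-next {a} m at) (trans (+-assoc a 4 _) a≡next) next≤t)))
      where
      scale′ : 2 * h * 2 ^ m ≡ 2 ^ p
      scale′ = trans (eq h (2 ^ m)) scale
        where
        eq : ∀ h q → 2 * h * q ≡ h * (2 * q)
        eq = solve-∀
      a+4≤next : a + 4 ≤ next
      a+4≤next = ≤-trans (+-monoʳ-≤ a (m≤m+n 4 _)) (≤-reflexive a≡next)
      a<next : a < next
      a<next = <-≤-trans (m<m+n a (s≤s z≤n)) a+4≤next
      cost : ∀ m → suc (3 + (36 + (4 + m * 40))) ≡ 4 + suc m * 40
      cost = solve-∀

  module _ (n τ base next len p : ℕ) (2^p≤N : 2 ^ p ≤ N)
           (at : At base p p) (base≡ : base + p * 4 ≡ next) (next≤t : next ≤ t) where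

    private
      sweepingₚ : List (Vec Bool p) → List (Vec Bool (suc p)) → Scratch → Config
      sweepingₚ ws acc z = sweeping n τ base next len ws acc z , μ

    exec-push-false : ∀ {ws acc r a o′} (w : Vec Bool p) o →
                      Exec B (ifnz (get 17) (push (get 14)) skip)
                             (sweepingₚ ws acc (suc (val w) , r , a , b2n o , o′)) 10
                             (sweepingₚ ws (pushIf outcome o (false ∷ w) acc) (suc (val w) , r , a , b2n o , o′))
    exec-push-false w true  =
      exec-then tt (λ ()) (exec-≔ tt refl ⨾ᵉ exec-≔ tt refl ⨾ᵉ exec-≔ tt refl ⨾ᵉ exec-≔ tt refl)
    exec-push-false w false = exec-≤ (m≤m+n 2 8) (exec-else tt refl exec-skip)

    exec-push-true : ∀ {ws acc r a o′} (w : Vec Bool p) o →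
                     Exec B (ifnz (get 18) (push (get 14 ⊕ get 2)) skip)
                            (sweepingₚ ws acc (suc (val w) , r , a , o′ , b2n o)) 12
                            (sweepingₚ ws (pushIf outcome o (true ∷ w) acc) (suc (val w) , r , a , o′ , b2n o))
    exec-push-true w true  =
      exec-then tt (λ ())
        (exec-≔ tt refl ⨾ᵉ exec-≔ tt refl ⨾ᵉ exec-≔ tt refl ⨾ᵉ
         exec-≔ (tt , tt , add≤ (≤-trans (val<2^ w) (≤-trans 2^p≤N (m≤m+n N _))) (≤-trans 2^p≤N (m≤m+n N _)))
                (cong suc (trans (+-comm (val w) (2 ^ p)) (cong (_+ val w) (sym (+-identityʳ (2 ^ p)))))))
    exec-push-true w false = exec-≤ (m≤m+n 2 10) (exec-else tt refl exec-skip)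

    exec-prepare : ∀ w ws {acc} z → length ws ≤ 3 →
                   Exec B prepare (sweepingₚ (w ∷ ws) acc z) 20
                                  (sweepingₚ ws acc (suc (val w) , 1 * val w , base , 1 , 1))
    exec-prepare w ws z len≤ =
      exec-≔ tt refl ⨾ᵉ
      (exec-≔ tt refl ⨾ᵉ exec-≔ tt refl ⨾ᵉ exec-≔ tt refl ⨾ᵉ exec-≔ tt (sym (code-beyond ws len≤))) ⨾ᵉ
      exec-≔ (tt , tt) (sym (*-identityˡ (val w))) ⨾ᵉ exec-≔ tt refl ⨾ᵉ exec-≔ tt refl ⨾ᵉ exec-≔ tt refl

    exec-try : ∀ w ws {acc} z → length ws ≤ 3 →
               ∃[ z′ ] Exec B try (sweepingₚ (w ∷ ws) acc z) (46 + p * 40)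
                 (sweepingₚ ws (pushIf outcome (extends outcome p true w) (true ∷ w)
                                (pushIf outcome (extends outcome p false w) (false ∷ w) acc)) z′)
    exec-try w ws {acc} z len≤ = _ , exec-≤ (≤-reflexive (cost (p * 40)))
      (exec-prepare w ws {acc} z len≤ ⨾ᵉ
       checks ⨾ᵉ
       exec-push-false {ws} {acc} w (extends outcome p false w) ⨾ᵉ
       exec-push-true {ws} {pushIf outcome (extends outcome p false w) (false ∷ w) acc} w (extends outcome p true w))
      where
      checks : Exec B (while (get 4 ⊖ get 16) check)
                    (sweepingₚ ws acc (suc (val w) , 1 * val w , base , 1 , 1)) (4 + p * 40)
                    (sweepingₚ ws acc (suc (val w) , 0 , next , b2n (extends outcome p false w)
                                                             , b2n (extends outcome p true w)))
      checks = exec-checks n τ base next len _ _ _ _ _ _ _ _ _ p 2^p≤N w {1} {o₀ = true} {o₁ = true}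
                 (*-identityˡ (2 ^ p)) at base≡ next≤t
      cost : ∀ x → 20 + (4 + x + 22) ≡ 46 + x
      cost x = cong (24 +_) (+-comm x 22)

    exec-tries : ∀ ws {acc} z → length ws ≤ 4 →
                 ∃[ z′ ] Exec B (while (get 6) try) (sweepingₚ ws acc z) (2 + length ws * (48 + p * 40))
                                (sweepingₚ [] (sweep outcome ws acc) z′)
    exec-tries []       z _           = z , exec-exit tt refl
    exec-tries (w ∷ ws) z (s≤s len≤) with exec-try w ws z len≤
    ... | z′ , e with exec-tries ws z′ (m≤n⇒m≤1+n len≤)
    ... | z″ , e′ = z″ , exec-≤ (≤-reflexive (cost (p * 40) (length ws * (48 + p * 40)))) (exec-loop tt (λ ()) e e′)
      where
      cost : ∀ x y → 2 + (46 + x + (2 + y)) ≡ 2 + (48 + x + y)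
      cost x y = cong (48 +_) (trans (+-suc x (suc y)) (cong suc (+-suc x y)))

    exec-level : ∀ ws z → len ≡ p * 4 → length ws ≤ 4 →
                 ∃[ z′ ] Exec B level (sweepingₚ ws [] z) (224 + p * 160)
                   (sweeping n τ next (next + suc p * 4) (suc p * 4) (sweep outcome ws []) [] z′ , μ)
    exec-level ws z len≡ ≤4 with exec-tries ws {[]} z ≤4
    ... | z′ , e = z′ , exec-≤ cost (e ⨾ᵉ
        exec-≔ tt refl ⨾ᵉ exec-≔ tt refl ⨾ᵉ exec-≔ tt refl ⨾ᵉ exec-≔ tt refl ⨾ᵉ
        exec-≔ tt refl ⨾ᵉ exec-≔ tt refl ⨾ᵉ exec-≔ tt refl ⨾ᵉ exec-≔ tt refl ⨾ᵉ
        exec-≔ (tt , tt , add≤ 2^p≤2N 2^p≤2N) (cong (2 ^ p +_) (sym (+-identityʳ (2 ^ p)))) ⨾ᵉ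
        exec-≔ (tt , tt , add≤ len≤2N (lit≤ ≤-refl)) (trans (+-comm len 4) (cong (4 +_) len≡)) ⨾ᵉ
        exec-≔ tt refl ⨾ᵉ
        exec-≔ (tt , tt , add≤ (≤-trans (≤-trans next≤t t≤N) (m≤m+n N _)) len′≤2N) refl)
      where
      2^p≤2N : 2 ^ p ≤ 2 * N
      2^p≤2N = ≤-trans 2^p≤N (m≤m+n N _)
      p*4≤N : p * 4 ≤ N
      p*4≤N = ≤-trans (≤-trans (m≤n+m (p * 4) base) (≤-reflexive base≡)) (≤-trans next≤t t≤N)
      len≤2N : len ≤ 2 * N
      len≤2N = ≤-trans (≤-reflexive len≡) (≤-trans p*4≤N (m≤m+n N _))
      len′≤2N : suc p * 4 ≤ 2 * N
      len′≤2N = +-mono-≤ 4≤N (≤-trans p*4≤N (m≤m+n N 0))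
      cost : 2 + length ws * (48 + p * 40) + 30 ≤ 224 + p * 160
      cost = begin
        2 + length ws * (48 + p * 40) + 30 ≤⟨ +-monoˡ-≤ 30 (+-monoʳ-≤ 2 (*-monoˡ-≤ (48 + p * 40) ≤4)) ⟩
        2 + 4 * (48 + p * 40) + 30         ≡⟨ cong (λ z → 2 + z + 30) (*-distribˡ-+ 4 48 (p * 40)) ⟩
        2 + (192 + 4 * (p * 40)) + 30      ≡⟨ +-comm (194 + 4 * (p * 40)) 30 ⟩
        224 + 4 * (p * 40)                 ≡⟨ cong (224 +_) (trans (*-comm 4 (p * 40)) (*-assoc p 40 4)) ⟩
        224 + p * 160                      ∎
        where open ≤-Reasoning

  -- The cost is telescoped: `blocks (suc p) * 97` stands for the tests already passed, and each
  -- level pays 97 for every test of its own block. The 4 is the final loop test.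
  exec-levels : ∀ q d p τ z → suc p + d ≡ q → blocks q ≤ t → 2 ^ q ≤ N →
                (∀ r → length (candidates outcome r) ≤ 4) →
                ∃[ z′ ] ∃[ c ] c + blocks (suc p) * 97 ≤ 4 + blocks q * 97 × Exec B (while (get 0 ⊖ get 2) level)
                  (sweeping (2 ^ q) τ (blocks (suc p)) (blocks (2 + p)) (suc p * 4) (candidates outcome p) [] z , μ)
                  c
                  (sweeping (2 ^ q) τ (blocks q) (blocks (suc q)) (q * 4) (candidates outcome (q ∸ 1)) [] z′ , μ)
  exec-levels q zero p τ z eq ≤t ≤N len≤ with refl ← trans (sym (+-identityʳ (suc p))) eq =
    z , 4 , ≤-refl , exec-exit (tt , tt) (n∸n≡0 (2 ^ q))
  exec-levels q (suc d) p τ z eq ≤t ≤N len≤ =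
    z″ , suc (3 + (224 + suc p * 160 + c)) , cost ,
    exec-loop (tt , tt) (∸≢0 {n = 2 ^ suc p} (^-monoʳ-< 2 (s≤s (s≤s z≤n)) p<q)) (proj₂ one) e′
    where
    p<q : suc p < q
    p<q = ≤-trans (m≤m+n (2 + p) d) (≤-reflexive (trans (sym (+-suc (suc p) d)) eq))
    one = exec-level (2 ^ q) τ (blocks (suc p)) (blocks (2 + p)) (suc p * 4) (suc p)
           (≤-trans (^-monoʳ-≤ 2 (<⇒≤ p<q)) ≤N) (At-blocks p) refl (≤-trans (blocks-mono p<q) ≤t)
           (candidates outcome p) z refl (len≤ p)
    rest = exec-levels q d (suc p) τ (proj₁ one) (trans (sym (+-suc (suc p) d)) eq) ≤t ≤N len≤
    z″ = proj₁ rest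
    c = proj₁ (proj₂ rest)
    c≤ = proj₁ (proj₂ (proj₂ rest))
    e′ = proj₂ (proj₂ (proj₂ rest))
    cost : suc (3 + (224 + suc p * 160 + c)) + blocks (suc p) * 97 ≤ 4 + blocks q * 97
    cost = begin
      4 + (224 + suc p * 160 + c) + blocks (suc p) * 97  ≤⟨ +-monoˡ-≤ (blocks (suc p) * 97) (+-monoˡ-≤ c (step-cost p)) ⟩
      suc p * 4 * 97 + c + blocks (suc p) * 97           ≡⟨ regroup (suc p * 4 * 97) c (blocks (suc p) * 97) ⟩
      c + (blocks (suc p) * 97 + suc p * 4 * 97)         ≡⟨ cong (c +_) (*-distribʳ-+ 97 (blocks (suc p)) (suc p * 4)) ⟨
      c + blocks (2 + p) * 97                            ≤⟨ c≤ ⟩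
      4 + blocks q * 97                                  ∎
      where open ≤-Reasoning

-- The majority vote and the output phase

majority : Bool → Bool → Bool → Bool → Bool
majority b₁ b₂ b₃ b₄ = 3 ≤ᵇ b2n b₁ + b2n b₂ + b2n b₃ + b2n b₄

b2n-≤ᵇ : ∀ k s → b2n (suc k ≤ᵇ s) ≡ 1 ∸ (suc k ∸ s)
b2n-≤ᵇ k       zero    = sym (0∸n≡0 k)
b2n-≤ᵇ zero    (suc s) = cong (1 ∸_) (sym (0∸n≡0 s))
b2n-≤ᵇ (suc k) (suc s) = b2n-≤ᵇ k s

majorities : ∀ {m} → Vec Bool m → Vec Bool m → Vec Bool m → Vec Bool m → Vec Bool m
majorities []         []         []         []         = []
majorities (b₁ ∷ w₁) (b₂ ∷ w₂) (b₃ ∷ w₃) (b₄ ∷ w₄) = majority b₁ b₂ b₃ b₄ ∷ majorities w₁ w₂ w₃ w₄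

kept : ∀ {p} → ℕ → List (Vec Bool p) → List (Vec Bool p)
kept m = filter (λ w → ¬? (suc (val w) ≟ m))

vote : ∀ {p} → List (Vec Bool p) → ℕ
vote (w₁ ∷ w₂ ∷ w₃ ∷ w₄ ∷ _) = suc (val (majorities w₁ w₂ w₃ w₄))
vote _                       = 0

results : ∀ {p} → List (Vec Bool p) → List (Vec Bool p)
results ws = kept (vote ws) ws

-- Replaces an equality test: of the two truncated differences at least one is positive unless the
-- operands are equal.
gap : ℕ → ℕ → ℕ
gap a b = (a ∸ b) + (b ∸ a)

gap≢0 : ∀ {a b} → a ≢ b → gap a b ≢ 0
gap≢0 {a} {b} a≢b eq =
  a≢b (≤-antisym (m∸n≡0⇒m≤n (m+n≡0⇒m≡0 _ eq)) (m∸n≡0⇒m≤n (m+n≡0⇒n≡0 (a ∸ b) eq)))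

gap≡0 : ∀ {a b} → a ≡ b → gap a b ≡ 0
gap≡0 {a} refl = cong₂ _+_ (n∸n≡0 a) (n∸n≡0 a)

Written : (ℕ → ℕ) → ℕ → ℕ → Set
Written μ c y = ∃[ i ] i < c × μ (suc i) ≡ y

module _ (n N B : ℕ) (8N≤B : 8 * N ≤ B) (4≤N : 4 ≤ N) (n≤N : n ≤ N) (0<n : 0 < n) where

  private
    add≤ : ∀ {a b} → a ≤ 2 * N → b ≤ 2 * N → a + b ≤ B
    add≤ = sum≤ {N} 8N≤B

    lit≤ : ∀ {a} → a ≤ 4 → a ≤ 2 * N
    lit≤ a≤ = ≤-trans a≤ (≤-trans 4≤N (m≤m+n N _))

  -- The doubled register is `b * n` plus a remainder below `n`, so `1 ∸ (n ∸ d)` evaluates to the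
  -- bit. Looking up `b * n` in the table removes the bit without a branch or a multiplication.
  exec-peel : ∀ r {l m τ π s y h μ} b {w : Vec Bool m} → μ 0 ≡ 0 → μ 1 ≡ n → 2 * h * 2 ^ m ≡ n →
              nth l r ≡ h * val (b ∷ w) → s ≤ 4 →
              Exec B (peel (5 + r)) (n ∷ τ ∷ π ∷ s ∷ y ∷ l , μ) 19
                     (n ∷ τ ∷ π ∷ s + b2n b ∷ b2n b ∷ upd l r (2 * h * val w) , μ)
  exec-peel r {l} {m} {s = s} {h = h} {μ} b {w} μ0 μ1 scale r≡ s≤4 =
    exec-≔ (tt , tt , tt , tt , no-overflow) (bit b double) ⨾ᵉ
    exec-≔ ((tt , tt , no-overflow) , tt) (rest b double) ⨾ᵉ
    exec-≔ (tt , tt , add≤ (lit≤ s≤4) (bit≤ b)) refl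
    where
    c = 2 * h * val w
    expand : ∀ h b q v → h * (b * q + v) + h * (b * q + v) ≡ b * (2 * h * q) + 2 * h * v
    expand = solve-∀
    double : nth l r + nth l r ≡ b2n b * n + c
    double = trans (cong₂ _+_ r≡ r≡) (trans (expand h (b2n b) (2 ^ m) (val w)) (cong (λ z → b2n b * z + c) scale))
    c<n : c < n
    c<n = scaled-val< (2 * h) w scale 0<n
    no-overflow : nth l r + nth l r ≤ B
    no-overflow = subst (_≤ B) (sym double)
      (add≤ (≤-trans (bound b) (≤-trans n≤N (m≤m+n N _))) (≤-trans (<⇒≤ c<n) (≤-trans n≤N (m≤m+n N _))))
      where
      bound : ∀ b → b2n b * n ≤ n
      bound false = z≤n
      bound true  = ≤-reflexive (+-identityʳ n)
    bit≤ : ∀ b → b2n b ≤ 2 * N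
    bit≤ false = z≤n
    bit≤ true  = lit≤ (s≤s z≤n)
    bit : ∀ b {d} → d ≡ b2n b * n + c → 1 ∸ (n ∸ d) ≡ b2n b
    bit false refl = m≤n⇒m∸n≡0 (m<n⇒0<n∸m c<n)
    bit true  refl = cong (1 ∸_) (m≤n⇒m∸n≡0 (≤-trans (m≤m+n n 0) (m≤m+n (n + 0) c)))
    rest : ∀ b {d} → d ≡ b2n b * n + c → d ∸ μ (b2n b) ≡ c
    rest false refl = cong (c ∸_) μ0
    rest true  refl = trans (cong₂ (λ x y → x + c ∸ y) (+-identityʳ n) μ1) (m+n∸m≡n n c)

  module _ (τ π k₀ k₁ k₂ k₃ j₀ j₁ j₂ j₃ : ℕ) {μ : ℕ → ℕ} (μ0 : μ 0 ≡ 0) (μ1 : μ 1 ≡ n) where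

    voting : ℕ → ℕ → ℕ → ℕ → List ℕ → Config
    voting s y c v l =
      n ∷ τ ∷ π ∷ s ∷ y ∷ c ∷ k₀ ∷ k₁ ∷ k₂ ∷ k₃ ∷ j₀ ∷ j₁ ∷ j₂ ∷ j₃ ∷ v ∷ l , μ

    scaled : ∀ {m} → ℕ → (w₁ w₂ w₃ w₄ : Vec Bool m) → List ℕ
    scaled h w₁ w₂ w₃ w₄ = h * val w₁ ∷ h * val w₂ ∷ h * val w₃ ∷ h * val w₄ ∷ []

    exec-round : ∀ {m s y h v} b₁ b₂ b₃ b₄ {w₁ w₂ w₃ w₄ : Vec Bool m} → 2 * h * 2 ^ m ≡ n → v < h →
                 Exec B round (voting s y (suc m * 4) v (scaled h (b₁ ∷ w₁) (b₂ ∷ w₂) (b₃ ∷ w₃) (b₄ ∷ w₄))) 92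
                              (voting (b2n b₁ + b2n b₂ + b2n b₃ + b2n b₄) (b2n b₄) (m * 4)
                                      (v + v + b2n (majority b₁ b₂ b₃ b₄)) (scaled (2 * h) w₁ w₂ w₃ w₄))
    exec-round {m} {h = h} {v} b₁ b₂ b₃ b₄ {w₁} {w₂} {w₃} {w₄} scale v<h =
      exec-≔ tt refl ⨾ᵉ
      exec-peel 10 {h = h} b₁ {w₁} μ0 μ1 scale refl z≤n ⨾ᵉ
      exec-peel 11 {h = h} b₂ {w₂} μ0 μ1 scale refl (≤-trans s₁ (m≤m+n 1 3)) ⨾ᵉ
      exec-peel 12 {h = h} b₃ {w₃} μ0 μ1 scale refl (≤-trans s₂ (m≤m+n 2 2)) ⨾ᵉ
      exec-peel 13 {h = h} b₄ {w₄} μ0 μ1 scale refl (≤-trans s₃ (m≤m+n 3 1)) ⨾ᵉ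
      exec-≔ ((tt , tt , add≤ v≤ v≤) , (tt , tt , tt) , add≤ 2v≤ (≤-trans (m∸n≤m 1 (3 ∸ s)) (lit≤ (s≤s z≤n))))
             (cong (v + v +_) (sym (b2n-≤ᵇ 2 s))) ⨾ᵉ
      exec-≔ (tt , tt) refl
      where
      s = b2n b₁ + b2n b₂ + b2n b₃ + b2n b₄
      bit≤1 : ∀ b → b2n b ≤ 1
      bit≤1 false = z≤n
      bit≤1 true  = ≤-refl
      s₁ = bit≤1 b₁
      s₂ = +-mono-≤ s₁ (bit≤1 b₂)
      s₃ = +-mono-≤ s₂ (bit≤1 b₃)
      2v≤n : v + v ≤ n
      2v≤n = ≤-trans (+-mono-≤ (<⇒≤ v<h) (≤-trans (<⇒≤ v<h) (m≤m+n h 0)))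
               (≤-trans (m≤m*n (2 * h) (2 ^ m) ⦃ m^n≢0 2 m ⦄) (≤-reflexive scale))
      2v≤ : v + v ≤ 2 * N
      2v≤ = ≤-trans 2v≤n (≤-trans n≤N (m≤m+n N _))
      v≤ : v ≤ 2 * N
      v≤ = ≤-trans (m≤m+n v v) 2v≤

    -- Horner's scheme: `v` holds the leading bits of the vote found so far. The scale `h` doubles
    -- together with it, so `v < h` persists and bounds `v` by `n`, which rules out overflow.
    exec-rounds : ∀ {m} (w₁ w₂ w₃ w₄ : Vec Bool m) {s y h v} → h * 2 ^ m ≡ n → v < h →
                  ∃[ s′ ] ∃[ y′ ] ∃[ l ]
                  Exec B (while (get 5) round) (voting s y (m * 4) v (scaled h w₁ w₂ w₃ w₄)) (2 + m * 94)
                         (voting s′ y′ 0 (v * 2 ^ m + val (majorities w₁ w₂ w₃ w₄)) l)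
    exec-rounds [] [] [] [] {s} {y} {h} {v} scale v<h = s , y , _ ,
      subst (λ x → Exec B (while (get 5) round) (voting s y 0 v (scaled h [] [] [] [])) 2
                          (voting s y 0 x (scaled h [] [] [] [])))
            (trans (sym (*-identityʳ v)) (sym (+-identityʳ (v * 1)))) (exec-exit tt refl)
    exec-rounds {suc m} (b₁ ∷ w₁) (b₂ ∷ w₂) (b₃ ∷ w₃) (b₄ ∷ w₄) {s} {y} {h} {v} scale v<h =
      proj₁ rest , proj₁ (proj₂ rest) , proj₁ (proj₂ (proj₂ rest)) ,
      subst (λ x → Exec B (while (get 5) round) (voting s y (suc m * 4) v (scaled h (b₁ ∷ w₁) (b₂ ∷ w₂) (b₃ ∷ w₃) (b₄ ∷ w₄)))
                          (2 + suc m * 94) (voting (proj₁ rest) (proj₁ (proj₂ rest)) 0 x (proj₁ (proj₂ (proj₂ rest)))))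
            (horner v (b2n b) (2 ^ m) (val (majorities w₁ w₂ w₃ w₄)))
            (exec-loop tt (λ ())
              (exec-round b₁ b₂ b₃ b₄ {w₁} {w₂} {w₃} {w₄} scale′ v<h) (proj₂ (proj₂ (proj₂ rest))))
      where
      b = majority b₁ b₂ b₃ b₄
      scale′ : 2 * h * 2 ^ m ≡ n
      scale′ = trans (eq h (2 ^ m)) scale
        where
        eq : ∀ h q → 2 * h * q ≡ h * (2 * q)
        eq = solve-∀
      v′<2h : ∀ b → v + v + b2n b < 2 * h
      v′<2h b = begin-strict
        v + v + b2n b ≤⟨ +-monoʳ-≤ (v + v) (bit≤1 b) ⟩
        v + v + 1     ≡⟨ +-assoc v v 1 ⟩
        v + (v + 1)   ≡⟨ cong (v +_) (+-comm v 1) ⟩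
        v + suc v     <⟨ +-mono-<-≤ v<h v<h ⟩
        h + h         ≡⟨ cong (h +_) (+-identityʳ h) ⟨
        2 * h         ∎
        where
        open ≤-Reasoning
        bit≤1 : ∀ b → b2n b ≤ 1
        bit≤1 false = z≤n
        bit≤1 true  = ≤-refl
      rest = exec-rounds w₁ w₂ w₃ w₄ {b2n b₁ + b2n b₂ + b2n b₃ + b2n b₄} {b2n b₄} {2 * h} {v + v + b2n b} scale′ (v′<2h b)
      horner : ∀ v b q x → (v + v + b) * q + x ≡ v * (2 * q) + (b * q + x)
      horner = solve-∀

  module _ (n′ τ π a₃ a₄ a₅ j₀ j₁ j₂ m : ℕ) (l : List ℕ) (m≤N : m ≤ N) where

    emitting : ∀ {p} → List (Vec Bool p) → ℕ → (ℕ → ℕ) → Config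
    emitting ws c μ =
      n′ ∷ τ ∷ π ∷ a₃ ∷ a₄ ∷ a₅ ∷ code ws 0 ∷ code ws 1 ∷ code ws 2 ∷ code ws 3 ∷
      j₀ ∷ j₁ ∷ j₂ ∷ c ∷ m ∷ l , μ

    exec-pop : ∀ {p} (w : Vec Bool p) ws {c μ} → length ws ≤ 3 →
               Exec B pop (emitting (w ∷ ws) c μ) 8 (emitting ws c μ)
    exec-pop w ws ≤3 =
      exec-≔ tt refl ⨾ᵉ exec-≔ tt refl ⨾ᵉ exec-≔ tt refl ⨾ᵉ exec-≔ tt (sym (code-beyond ws ≤3))

    no-overflow : ∀ {p} (w : Vec Bool p) → 2 ^ p ≤ n → gap (suc (val w)) m ≤ B
    no-overflow w ≤n = add≤
      (≤-trans (m∸n≤m (suc (val w)) m) (≤-trans (val<2^ w) (≤-trans ≤n (≤-trans n≤N (m≤m+n N _)))))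
      (≤-trans (m∸n≤m m (suc (val w))) (≤-trans m≤N (m≤m+n N _)))

    exec-keep : ∀ {p} (w : Vec Bool p) ws {c μ} → length ws ≤ 3 → 2 ^ p ≤ n → c ≤ 3 → suc (val w) ≢ m →
                Exec B emit (emitting (w ∷ ws) c μ) 25 (emitting ws (suc c) (μ [ suc c ↦ val w ]))
    exec-keep w ws {c} ≤3 ≤n c≤3 w≢m =
      exec-then ((tt , tt) , (tt , tt) , no-overflow w ≤n) (gap≢0 w≢m)
        (exec-≔ (tt , tt , add≤ (lit≤ (m≤n⇒m≤1+n c≤3)) (lit≤ (s≤s z≤n))) (+-comm c 1) ⨾ᵉ
         exec-store tt (tt , tt) refl refl) ⨾ᵉ
      exec-pop w ws ≤3

    exec-drop : ∀ {p} (w : Vec Bool p) ws {c μ} → length ws ≤ 3 → 2 ^ p ≤ n → suc (val w) ≡ m →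
                Exec B emit (emitting (w ∷ ws) c μ) 16 (emitting ws c μ)
    exec-drop w ws ≤3 ≤n w≡m =
      exec-else ((tt , tt) , (tt , tt) , no-overflow w ≤n) (gap≡0 w≡m) exec-skip ⨾ᵉ
      exec-pop w ws ≤3

    written-suc : ∀ {μ c v y} → Written (μ [ suc c ↦ v ]) (suc c) y ⇔ (Written μ c y ⊎ y ≡ v)
    written-suc {μ} {c} {v} {y} = mk⇔ to from
      where
      to : Written (μ [ suc c ↦ v ]) (suc c) y → Written μ c y ⊎ y ≡ v
      to (i , s≤s i≤c , eq) with m≤n⇒m<n∨m≡n i≤c
      ... | inj₁ i<c  = inj₁ (i , i<c , trans (sym (↦-other μ (suc c) v (λ e → <⇒≢ i<c (sym (suc-injective e))))) eq)
      ... | inj₂ refl = inj₂ (trans (sym eq) (↦-same μ (suc c) v))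
      from : Written μ c y ⊎ y ≡ v → Written (μ [ suc c ↦ v ]) (suc c) y
      from (inj₁ (i , i<c , eq)) =
        i , m≤n⇒m≤1+n i<c , trans (↦-other μ (suc c) v (λ e → <⇒≢ i<c (sym (suc-injective e)))) eq
      from (inj₂ refl) = c , ≤-refl , ↦-same μ (suc c) v

    -- Stated relative to `c` words written earlier, so that the induction can pass through each
    -- store.
    exec-emits : ∀ {p} (ws : List (Vec Bool p)) {c μ} → c + length ws ≤ 4 → 2 ^ p ≤ n →
                 ∃[ μ′ ] (∀ y → Written μ′ (c + length (kept m ws)) y ⇔ (Written μ c y ⊎ y ∈ map val (kept m ws))) ×
                   Exec B (while (get 6) emit) (emitting ws c μ) (2 + length ws * 27)
                          (emitting {p} [] (c + length (kept m ws)) μ′)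
    exec-emits {p} [] {c} {μ} _ _ =
      μ ,
      (λ y → subst (λ c′ → Written μ c′ y ⇔ (Written μ c y ⊎ y ∈ [])) (sym (+-identityʳ c))
               (mk⇔ inj₁ λ where (inj₁ x) → x; (inj₂ ()))) ,
      subst (λ c′ → Exec B (while (get 6) emit) (emitting {p} [] c μ) 2 (emitting {p} [] c′ μ))
            (sym (+-identityʳ c)) (exec-exit tt refl)
    exec-emits {p} (w ∷ ws) {c} {μ} c≤ ≤n = case (suc (val w) ≟ m)
      where
      Goal : List (Vec Bool p) → Set
      Goal ks =
        ∃[ μ′ ] (∀ y → Written μ′ (c + length ks) y ⇔ (Written μ c y ⊎ y ∈ map val ks)) ×
          Exec B (while (get 6) emit) (emitting (w ∷ ws) c μ) (2 + length (w ∷ ws) * 27)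
                 (emitting {p} [] (c + length ks) μ′)
      c+ws≤3 : c + length ws ≤ 3
      c+ws≤3 = s≤s⁻¹ (≤-trans (≤-reflexive (sym (+-suc c (length ws)))) c≤)
      ws≤3 : length ws ≤ 3
      ws≤3 = ≤-trans (m≤n+m (length ws) c) c+ws≤3
      case : Dec (suc (val w) ≡ m) → Goal (kept m (w ∷ ws))
      case (yes w≡m) = subst Goal (sym (filter-reject (λ w → ¬? (suc (val w) ≟ m)) (λ w≢m → w≢m w≡m)))
        (proj₁ rest , proj₁ (proj₂ rest) ,
         exec-≤ (m≤n+m (20 + length ws * 27) 9) (exec-loop tt (λ ()) (exec-drop w ws ws≤3 ≤n w≡m) (proj₂ (proj₂ rest))))
        where rest = exec-emits ws {c} {μ} (m≤n⇒m≤1+n c+ws≤3) ≤n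
      case (no w≢m) = subst Goal (sym (filter-accept (λ w → ¬? (suc (val w) ≟ m)) w≢m)) (proj₁ rest ,
        (λ y → subst (λ c′ → Written (proj₁ rest) c′ y ⇔ (Written μ c y ⊎ y ∈ map val (w ∷ kept m ws))) (sym (+-suc c _))
                 (mk⇔ (to y) (from y))) ,
        subst (λ c′ → Exec B (while (get 6) emit) (emitting (w ∷ ws) c μ) (29 + length ws * 27)
                             (emitting {p} [] c′ (proj₁ rest))) (sym (+-suc c _))
          (exec-loop tt (λ ()) (exec-keep w ws ws≤3 ≤n (≤-trans (m≤m+n c _) c+ws≤3) w≢m) (proj₂ (proj₂ rest))))
        where
        rest = exec-emits ws {suc c} {μ [ suc c ↦ val w ]} (s≤s c+ws≤3) ≤n
        to : ∀ y → Written (proj₁ rest) (suc c + length (kept m ws)) y → Written μ c y ⊎ y ∈ map val (w ∷ kept m ws)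
        to y x with Equivalence.to (proj₁ (proj₂ rest) y) x
        ... | inj₂ y∈ = inj₂ (there y∈)
        ... | inj₁ x′ with Equivalence.to (written-suc {μ}) x′
        ... | inj₁ x″ = inj₁ x″
        ... | inj₂ refl = inj₂ (here refl)
        from : ∀ y → Written μ c y ⊎ y ∈ map val (w ∷ kept m ws) → Written (proj₁ rest) (suc c + length (kept m ws)) y
        from y (inj₁ x) = Equivalence.from (proj₁ (proj₂ rest) y) (inj₁ (Equivalence.from (written-suc {μ}) (inj₁ x)))
        from y (inj₂ (here refl)) =
          Equivalence.from (proj₁ (proj₂ rest) y) (inj₁ (Equivalence.from (written-suc {μ}) (inj₂ refl)))
        from y (inj₂ (there y∈)) = Equivalence.from (proj₁ (proj₂ rest) y) (inj₂ y∈)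

module _ (q N B : ℕ) (8N≤B : 8 * N ≤ B) (4≤N : 4 ≤ N) (2^q≤N : 2 ^ q ≤ N) where

  private
    0<2^q : 0 < 2 ^ q
    0<2^q = m^n>0 2 q

  module _ (τ a₃ a₄ r a o₀ o₁ : ℕ) where

    voted : List (Vec Bool q) → ℕ → ℕ → ℕ → ℕ → List ℕ → List ℕ
    voted ws a₃ a₄ c v l =
      2 ^ q ∷ τ ∷ 2 ^ q ∷ a₃ ∷ a₄ ∷ c ∷ code ws 0 ∷ code ws 1 ∷ code ws 2 ∷ code ws 3 ∷
      0 ∷ 0 ∷ 0 ∷ 0 ∷ v ∷ l

    exec-median : ∀ w₁ w₂ w₃ w₄ μ →
                  ∃[ a₃′ ] ∃[ a₄′ ] ∃[ l ]
                  Exec B median (voted (w₁ ∷ w₂ ∷ w₃ ∷ w₄ ∷ []) a₃ a₄ (q * 4) 0 (r ∷ a ∷ o₀ ∷ o₁ ∷ []) , μ)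
                    (28 + q * 94)
                    (voted (w₁ ∷ w₂ ∷ w₃ ∷ w₄ ∷ []) a₃′ a₄′ 0 (vote (w₁ ∷ w₂ ∷ w₃ ∷ w₄ ∷ [])) l ,
                     (μ [ 0 ↦ 0 ]) [ 1 ↦ 2 ^ q ])
    exec-median w₁ w₂ w₃ w₄ μ =
      proj₁ rounds , proj₁ (proj₂ rounds) , proj₁ (proj₂ (proj₂ rounds)) ,
      exec-≤ (≤-reflexive (cong (24 +_) (+-comm (q * 94) 4)))
        (exec-store tt tt refl refl ⨾ᵉ exec-store tt tt refl refl ⨾ᵉ
         exec-≔ (tt , tt) (sym (*-identityˡ (val w₁))) ⨾ᵉ exec-≔ (tt , tt) (sym (*-identityˡ (val w₂))) ⨾ᵉ
         exec-≔ (tt , tt) (sym (*-identityˡ (val w₃))) ⨾ᵉ exec-≔ (tt , tt) (sym (*-identityˡ (val w₄))) ⨾ᵉ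
         proj₂ (proj₂ (proj₂ rounds)) ⨾ᵉ
         exec-≔ (tt , tt , sum≤ {N} 8N≤B (≤-trans (<⇒≤ (val<2^ M)) (≤-trans 2^q≤N (m≤m+n N _)))
                                         (≤-trans (≤-trans (s≤s z≤n) 4≤N) (m≤m+n N _)))
                (+-comm (val M) 1))
      where
      M = majorities w₁ w₂ w₃ w₄
      rounds = exec-rounds (2 ^ q) N B 8N≤B 4≤N 2^q≤N 0<2^q τ (2 ^ q) _ _ _ _ 0 0 0 0 {μ = (μ [ 0 ↦ 0 ]) [ 1 ↦ 2 ^ q ]}
                 refl refl w₁ w₂ w₃ w₄ {a₃} {a₄} {1} {0} (*-identityˡ (2 ^ q)) (s≤s z≤n)

    Voted : List (Vec Bool q) → (ℕ → ℕ) → Set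
    Voted ws μ = ∃[ μ′ ] ∃[ a₃′ ] ∃[ a₄′ ] ∃[ c ] ∃[ l ]
      Exec B (ifnz (get 9) median skip) (voted ws a₃ a₄ (q * 4) 0 (r ∷ a ∷ o₀ ∷ o₁ ∷ []) , μ)
           (30 + q * 94)
           (voted ws a₃′ a₄′ c (vote ws) l , μ′)

    exec-vote : ∀ ws μ → length ws ≤ 4 → Voted ws μ
    exec-vote (w₁ ∷ w₂ ∷ w₃ ∷ w₄ ∷ []) μ _ =
      let a₃′ , a₄′ , l , e = exec-median w₁ w₂ w₃ w₄ μ in
      _ , a₃′ , a₄′ , 0 , l , exec-then tt (λ ()) e
    exec-vote (_ ∷ _ ∷ _ ∷ _ ∷ _ ∷ _) μ (s≤s (s≤s (s≤s (s≤s ()))))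
    exec-vote []               μ _ = μ , a₃ , a₄ , q * 4 , _ , exec-≤ (m≤m+n 2 _) (exec-else tt refl exec-skip)
    exec-vote (_ ∷ [])         μ _ = μ , a₃ , a₄ , q * 4 , _ , exec-≤ (m≤m+n 2 _) (exec-else tt refl exec-skip)
    exec-vote (_ ∷ _ ∷ [])     μ _ = μ , a₃ , a₄ , q * 4 , _ , exec-≤ (m≤m+n 2 _) (exec-else tt refl exec-skip)
    exec-vote (_ ∷ _ ∷ _ ∷ []) μ _ = μ , a₃ , a₄ , q * 4 , _ , exec-≤ (m≤m+n 2 _) (exec-else tt refl exec-skip)

    vote≤N : ∀ ws → vote {q} ws ≤ N
    vote≤N (w₁ ∷ w₂ ∷ w₃ ∷ w₄ ∷ _) = ≤-trans (val<2^ (majorities w₁ w₂ w₃ w₄)) 2^q≤N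
    vote≤N []              = z≤n
    vote≤N (_ ∷ [])         = z≤n
    vote≤N (_ ∷ _ ∷ [])     = z≤n
    vote≤N (_ ∷ _ ∷ _ ∷ []) = z≤n

    exec-output : ∀ ws x μ → length ws ≤ 4 →
                  Σ[ μ′ ∈ (ℕ → ℕ) ] ∃[ l ] μ′ 0 ≡ length (results ws) ×
                    (∀ y → Written μ′ (length (results ws)) y ⇔ y ∈ map val (results ws)) ×
                    Exec B output (voted ws a₃ a₄ (q * 4) x (r ∷ a ∷ o₀ ∷ o₁ ∷ []) , μ) (145 + q * 94) (l , μ′)
    exec-output ws x μ ≤4 =
      let μ₁ , a₃′ , a₄′ , c , l , e₁ = exec-vote ws μ ≤4
          μ₂ , written , e₂ = exec-emits (2 ^ q) N B 8N≤B 4≤N 2^q≤N 0<2^q (2 ^ q) τ (2 ^ q) a₃′ a₄′ c 0 0 0 (vote ws) l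
                                (vote≤N ws) ws {0} {μ₁} ≤4 ≤-refl
      in _ , _ , refl ,
         (λ y → mk⇔ (λ z → [ (λ where (_ , () , _)) , (λ y∈ → y∈) ]′ (Equivalence.to (written y) z))
                    (λ y∈ → Equivalence.from (written y) (inj₂ y∈))) ,
         exec-≤ (cost (length ws) ≤4) (exec-≔ tt refl ⨾ᵉ e₁ ⨾ᵉ e₂ ⨾ᵉ exec-store tt tt refl refl)
      where
      cost : ∀ k → k ≤ 4 → 2 + (30 + q * 94 + (2 + k * 27 + 3)) ≤ 145 + q * 94
      cost k k≤4 = ≤-trans (+-monoʳ-≤ (32 + q * 94) (+-monoˡ-≤ 3 (+-monoʳ-≤ 2 (*-monoˡ-≤ 27 k≤4))))
                     (≤-reflexive (cong (32 +_) (+-comm (q * 94) 113)))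

-- Word size and total cost of the decoder

8N≤N² : ∀ {N} → 8 ≤ N → 8 * N ≤ N ^ 2
8N≤N² {N} 8≤N = ≤-trans (*-monoˡ-≤ N 8≤N) (≤-reflexive (cong (N *_) (sym (*-identityʳ N))))

-- Lets the number of tests absorb the constant costs and the cost of the vote, which is linear in
-- the word length. Length one would leave no test to charge.
2q≤blocks : ∀ q → (2 + q) * 2 ≤ blocks (2 + q)
2q≤blocks zero    = ≤-refl
2q≤blocks (suc q) =
  ≤-trans (≤-reflexive (+-comm 2 ((2 + q) * 2)))
          (+-mono-≤ (2q≤blocks q) (s≤s (s≤s z≤n)))

exec-decoder : ∀ outcome q (μ : ℕ → ℕ) → 2 ≤ q →
  (∀ r → r < blocks q → μ r ≡ b2n (outcome (test r))) →
  (∀ p → length (candidates outcome p) ≤ 4) →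
  Σ[ μ′ ∈ (ℕ → ℕ) ] ∃[ l ]
    let R = results (candidates outcome (q ∸ 1)) in
    μ′ 0 ≡ length R × (∀ y → Written μ′ (length R) y ⇔ y ∈ map val R) ×
    Exec ((2 ^ q + blocks q) ^ 2) decoder (2 ^ q ∷ blocks q ∷ [] , μ) (232 * blocks q) (l , μ′)
exec-decoder outcome 1 μ (s≤s ())
exec-decoder outcome q@(suc q′@(suc q″)) μ 2≤q reads ≤4 =
  let z , c , c≤ , e₁ = exec-levels outcome μ (blocks q) N (N ^ 2) reads 8N≤B 4≤N t≤N q q′ 0 (blocks q)
                          (0 , 0 , 0 , 0 , 0) refl ≤-refl 2^q≤N ≤4
      x , r , a , o₀ , o₁ = z
      μ′ , l , out , written , e₂ = exec-output q N (N ^ 2) 8N≤B 4≤N 2^q≤N (blocks q) (blocks q) (blocks (suc q)) r a o₀ o₁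
                                      (candidates outcome q′) x μ (≤4 q′)
  in μ′ , l , out , written ,
     exec-≤ (cost c c≤)
       ((exec-≔ tt refl ⨾ᵉ exec-≔ tt refl ⨾ᵉ exec-≔ tt refl ⨾ᵉ exec-≔ tt refl ⨾ᵉ exec-≔ tt refl ⨾ᵉ exec-≔ tt refl) ⨾ᵉ
        e₁ ⨾ᵉ e₂)
  where
  N = 2 ^ q + blocks q
  2q≤t : q * 2 ≤ blocks q
  2q≤t = 2q≤blocks q″
  4≤t : 4 ≤ blocks q
  4≤t = ≤-trans (*-monoˡ-≤ 2 2≤q) 2q≤t
  2^q≤N : 2 ^ q ≤ N
  2^q≤N = m≤m+n (2 ^ q) (blocks q)
  t≤N : blocks q ≤ N
  t≤N = m≤n+m (blocks q) (2 ^ q)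
  4≤N : 4 ≤ N
  4≤N = ≤-trans 4≤t t≤N
  -- Both `2 ^ q` and the number of tests are at least 4, so `N` is at least 8 and the exponent 2
  -- suffices for the word size.
  8N≤B : 8 * N ≤ N ^ 2
  8N≤B = 8N≤N² {N} (+-mono-≤ (^-monoʳ-≤ 2 2≤q) 4≤t)
  -- The constants sum to 12 + 4 + 145 = 161, at most 41 per test because there are at least 4
  -- tests; `q` is at most the number of tests; and 41 + 94 + 97 = 232.
  cost : ∀ c → c + 0 ≤ 4 + blocks q * 97 → 12 + (c + (145 + q * 94)) ≤ 232 * blocks q
  cost c c≤ = begin
    12 + (c + (145 + q * 94))                       ≤⟨ +-monoʳ-≤ 12 (+-monoˡ-≤ (145 + q * 94) (≤-trans (m≤m+n c 0) c≤)) ⟩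
    16 + (t * 97 + (145 + q * 94))                  ≡⟨ cong (16 +_) (+-comm (t * 97) (145 + q * 94)) ⟩
    161 + (q * 94 + t * 97)                         ≤⟨ +-mono-≤ 161≤ (+-monoˡ-≤ (t * 97) (*-monoˡ-≤ 94 q≤t)) ⟩
    t * 41 + (t * 94 + t * 97)                      ≡⟨ cong (t * 41 +_) (*-distribˡ-+ t 94 97) ⟨
    t * 41 + t * 191                                ≡⟨ *-distribˡ-+ t 41 191 ⟨
    t * 232                                         ≡⟨ *-comm t 232 ⟩
    232 * t                                         ∎
    where
    open ≤-Reasoning
    t = blocks q
    q≤t : q ≤ t
    q≤t = ≤-trans (m≤m*n q 2) 2q≤t
    161≤ : 161 ≤ t * 41
    161≤ = ≤-trans (m≤m+n 161 3) (*-monoˡ-≤ 41 4≤t)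

-- The words consistent with the outcomes

-- The pigeonhole principle in a form that yields both the bound on lengths and, when the lengths
-- agree, a permutation.
unique-⊆ : ∀ {A : Set} {xs ys : List A} → Unique xs → xs ⊆ ys → ∃[ zs ] ys ↭ xs ++ zs
unique-⊆ {xs = []}     []          _     = _ , ↭-refl
unique-⊆ {xs = x ∷ xs} u@(_ ∷ xs!) xs⊆ys with ∈-∃++ (xs⊆ys (here refl))
... | ys₁ , ys₂ , refl with unique-⊆ xs! xs⊆
  where
  xs⊆ : xs ⊆ ys₁ ++ ys₂
  xs⊆ z∈ with ∈-++⁻ ys₁ (xs⊆ys (there z∈))
  ... | inj₁ z∈₁           = ∈-++⁺ˡ z∈₁
  ... | inj₂ (here refl)   = contradiction z∈ (Unique[x∷xs]⇒x∉xs u)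
  ... | inj₂ (there z∈₂)   = ∈-++⁺ʳ ys₁ z∈₂
... | zs , perm = zs , ↭-trans (shift x ys₁ ys₂) (↭-prep x perm)

unique-length : ∀ {A : Set} {xs ys : List A} → Unique xs → xs ⊆ ys → length xs ≤ length ys
unique-length {xs = xs} xs! xs⊆ys with unique-⊆ xs! xs⊆ys
... | zs , perm = ≤-trans (m≤m+n _ _) (≤-reflexive (sym (trans (↭-length perm) (length-++ xs))))

unique-⊆-↭ : ∀ {A : Set} {xs ys : List A} → Unique xs → xs ⊆ ys → length ys ≤ length xs → ys ↭ xs
unique-⊆-↭ {xs = xs} {ys} xs! xs⊆ys len≤ with unique-⊆ xs! xs⊆ys
... | [] , perm = subst (ys ↭_) (++-identityʳ xs) perm
... | z ∷ zs , perm = contradiction len≤ (<⇒≱ (begin-strict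
  length xs                   <⟨ m<m+n (length xs) (s≤s z≤n) ⟩
  length xs + length (z ∷ zs) ≡⟨ length-++ xs ⟨
  length (xs ++ z ∷ zs)       ≡⟨ ↭-length perm ⟨
  length ys                   ∎))
  where open ≤-Reasoning

-- Binary expansions

odd : ℕ → Bool
odd zero          = false
odd (suc zero)    = true
odd (suc (suc n)) = odd n

bit : ℕ → ℕ → Bool
bit j zero    = odd j
bit j (suc i) = bit ⌊ j /2⌋ i

odd+2*half : ∀ j → b2n (odd j) + 2 * ⌊ j /2⌋ ≡ j
odd+2*half zero          = refl
odd+2*half (suc zero)    = refl
odd+2*half (suc (suc j)) = trans (step (b2n (odd j)) ⌊ j /2⌋) (cong (2 +_) (odd+2*half j))
  where
  step : ∀ b h → b + 2 * suc h ≡ 2 + (b + 2 * h)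
  step = solve-∀

word : (ℕ → Bool) → ∀ p → Vec Bool p
word f zero    = []
word f (suc p) = f p ∷ word f p

-- Words grow at the leading end, whereas `bit` halves from the trailing end. Splitting off the last
-- bit instead makes the induction of `val-word` follow the halving.
val-word-suc : ∀ j p → val (word (bit j) (suc p)) ≡ b2n (odd j) + 2 * val (word (bit ⌊ j /2⌋) p)
val-word-suc j zero    = trans (+-identityʳ _) (trans (*-identityʳ _) (sym (+-identityʳ _)))
val-word-suc j (suc p) =
  trans (cong (b2n (bit ⌊ j /2⌋ p) * 2 ^ suc p +_) (val-word-suc j p))
        (step (b2n (bit ⌊ j /2⌋ p)) (2 ^ p) (b2n (odd j)) (val (word (bit ⌊ j /2⌋) p)))
  where
  step : ∀ b q o v → b * (2 * q) + (o + 2 * v) ≡ o + 2 * (b * q + v)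
  step = solve-∀

val-word : ∀ q {j} → j < 2 ^ q → val (word (bit j) q) ≡ j
val-word zero    {zero} _ = refl
val-word zero    {suc _} (s≤s ())
val-word (suc q) {j} j<  = begin
  val (word (bit j) (suc q))                         ≡⟨ val-word-suc j q ⟩
  b2n (odd j) + 2 * val (word (bit ⌊ j /2⌋) q)       ≡⟨ cong (λ v → b2n (odd j) + 2 * v) (val-word q half<) ⟩
  b2n (odd j) + 2 * ⌊ j /2⌋                          ≡⟨ odd+2*half j ⟩
  j                                                  ∎
  where
  open ≡-Reasoning
  half< : ⌊ j /2⌋ < 2 ^ q
  half< = *-cancelˡ-< 2 _ _ (≤-<-trans (≤-trans (m≤n+m (2 * ⌊ j /2⌋) (b2n (odd j))) (≤-reflexive (odd+2*half j))) j<)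

val-injective : ∀ {p} (u w : Vec Bool p) → val u ≡ val w → u ≡ w
val-injective []          []          _  = refl
val-injective (false ∷ u) (false ∷ w) eq = cong (false ∷_) (val-injective u w eq)
val-injective (true ∷ u)  (true ∷ w)  eq = cong (true ∷_) (val-injective u w (+-cancelˡ-≡ _ (val u) (val w) eq))
val-injective {suc p} (true ∷ u)  (false ∷ w) eq =
  contradiction (val<2^ w) (≤⇒≯ (≤-trans (≤-trans (m≤m+n (2 ^ p) 0) (m≤m+n _ (val u))) (≤-reflexive eq)))
val-injective {suc p} (false ∷ u) (true ∷ w)  eq =
  contradiction (val<2^ u) (≤⇒≯ (≤-trans (≤-trans (m≤m+n (2 ^ p) 0) (m≤m+n _ (val w))) (≤-reflexive (sym eq))))

word-val : ∀ {p} (w : Vec Bool p) → word (bit (val w)) p ≡ w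
word-val {p} w = val-injective _ w (val-word p (val<2^ w))

word-cong : ∀ {f g} p → (∀ i → i < p → f i ≡ g i) → word f p ≡ word g p
word-cong zero    eq = refl
word-cong (suc p) eq = cong₂ _∷_ (eq p ≤-refl) (word-cong p (λ i i<p → eq i (m≤n⇒m≤1+n i<p)))

agree? : ∀ f g p → (word f p ≡ word g p) ⊎ (∃[ i ] i < p × f i ≢ g i)
agree? f g zero = inj₁ refl
agree? f g (suc p) with f p ≟ᵇ g p | agree? f g p
... | no f≢g | _                    = inj₂ (p , ≤-refl , f≢g)
... | yes _  | inj₂ (i , i<p , f≢g) = inj₂ (i , m≤n⇒m≤1+n i<p , f≢g)
... | yes eq | inj₁ eqs             = inj₁ (cong₂ _∷_ eq eqs)

-- Medians of three words and majorities of four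

maj : Bool → Bool → Bool → Bool
maj a b c = if a then b ∨ c else b ∧ c

maj-two : ∀ a b c → let m = maj a b c in (m ≡ a × m ≡ b) ⊎ (m ≡ a × m ≡ c) ⊎ (m ≡ b × m ≡ c)
maj-two false false c     = inj₁ (refl , refl)
maj-two true  true  c     = inj₁ (refl , refl)
maj-two false true  false = inj₂ (inj₁ (refl , refl))
maj-two true  false true  = inj₂ (inj₁ (refl , refl))
maj-two false true  true  = inj₂ (inj₂ (refl , refl))
maj-two true  false false = inj₂ (inj₂ (refl , refl))

-- At each of two positions at least two of the three words agree with the median, and two pairs out
-- of three share a member. This is why the median passes every test.
meet-maj : ∀ a b c a′ b′ c′ → let m = maj a b c ; m′ = maj a′ b′ c′ in
           (a ≡ m × a′ ≡ m′) ⊎ (b ≡ m × b′ ≡ m′) ⊎ (c ≡ m × c′ ≡ m′)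
meet-maj a b c a′ b′ c′ with maj-two a b c | maj-two a′ b′ c′
... | inj₁ (x , _)        | inj₁ (y , _)        = inj₁ (sym x , sym y)
... | inj₁ (x , _)        | inj₂ (inj₁ (y , _)) = inj₁ (sym x , sym y)
... | inj₁ (_ , x)        | inj₂ (inj₂ (y , _)) = inj₂ (inj₁ (sym x , sym y))
... | inj₂ (inj₁ (x , _)) | inj₁ (y , _)        = inj₁ (sym x , sym y)
... | inj₂ (inj₁ (x , _)) | inj₂ (inj₁ (y , _)) = inj₁ (sym x , sym y)
... | inj₂ (inj₁ (_ , x)) | inj₂ (inj₂ (_ , y)) = inj₂ (inj₂ (sym x , sym y))
... | inj₂ (inj₂ (x , _)) | inj₁ (_ , y)        = inj₂ (inj₁ (sym x , sym y))
... | inj₂ (inj₂ (_ , x)) | inj₂ (inj₁ (_ , y)) = inj₂ (inj₂ (sym x , sym y))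
... | inj₂ (inj₂ (x , _)) | inj₂ (inj₂ (y , _)) = inj₂ (inj₁ (sym x , sym y))

avoid-maj : ∀ {x} a b c → x ≢ maj a b c → (x ≢ a × x ≢ b) ⊎ (x ≢ a × x ≢ c) ⊎ (x ≢ b × x ≢ c)
avoid-maj {x} a b c x≢ with maj-two a b c
... | inj₁ (p , q)        = inj₁ ((λ e → x≢ (trans e (sym p))) , (λ e → x≢ (trans e (sym q))))
... | inj₂ (inj₁ (p , q)) = inj₂ (inj₁ ((λ e → x≢ (trans e (sym p))) , (λ e → x≢ (trans e (sym q)))))
... | inj₂ (inj₂ (p , q)) = inj₂ (inj₂ ((λ e → x≢ (trans e (sym p))) , (λ e → x≢ (trans e (sym q)))))

-- The fourth bit is a third vote for the value held by two of the others; the opposite value has at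
-- most one vote.
majority-maj : ∀ a b c → majority a b c (maj a b c) ≡ maj a b c
majority-maj false false false = refl
majority-maj false false true  = refl
majority-maj false true  false = refl
majority-maj false true  true  = refl
majority-maj true  false false = refl
majority-maj true  false true  = refl
majority-maj true  true  false = refl
majority-maj true  true  true  = refl

med : ∀ {p} → Vec Bool p → Vec Bool p → Vec Bool p → Vec Bool p
med []      []      []      = []
med (a ∷ u) (b ∷ v) (c ∷ w) = maj a b c ∷ med u v w

word-med : ∀ f g h p → word (λ i → maj (f i) (g i) (h i)) p ≡ med (word f p) (word g p) (word h p)
word-med f g h zero    = refl
word-med f g h (suc p) = cong (maj (f p) (g p) (h p) ∷_) (word-med f g h p)

med-aab : ∀ {p} (a b : Vec Bool p) → med a a b ≡ a
med-aab []          []      = refl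
med-aab (false ∷ a) (_ ∷ b) = cong (_ ∷_) (med-aab a b)
med-aab (true ∷ a)  (_ ∷ b) = cong (_ ∷_) (med-aab a b)

med-aba : ∀ {p} (a b : Vec Bool p) → med a b a ≡ a
med-aba []          []          = refl
med-aba (false ∷ a) (false ∷ b) = cong (_ ∷_) (med-aba a b)
med-aba (false ∷ a) (true ∷ b)  = cong (_ ∷_) (med-aba a b)
med-aba (true ∷ a)  (false ∷ b) = cong (_ ∷_) (med-aba a b)
med-aba (true ∷ a)  (true ∷ b)  = cong (_ ∷_) (med-aba a b)

med-baa : ∀ {p} (a b : Vec Bool p) → med b a a ≡ a
med-baa []          []          = refl
med-baa (false ∷ a) (false ∷ b) = cong (_ ∷_) (med-baa a b)
med-baa (false ∷ a) (true ∷ b)  = cong (_ ∷_) (med-baa a b)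
med-baa (true ∷ a)  (false ∷ b) = cong (_ ∷_) (med-baa a b)
med-baa (true ∷ a)  (true ∷ b)  = cong (_ ∷_) (med-baa a b)

majorities-med : ∀ {p} (a b c : Vec Bool p) → majorities a b c (med a b c) ≡ med a b c
majorities-med []      []      []      = refl
majorities-med (a ∷ u) (b ∷ v) (c ∷ w) = cong₂ _∷_ (majority-maj a b c) (majorities-med u v w)

-- The search returns its words in no known order, so the vote must find the median without knowing
-- which slot holds it. It depends only on the number of ones.
majority-↭ : ∀ {a b c d a′ b′ c′ d′} → a ∷ b ∷ c ∷ d ∷ [] ↭ a′ ∷ b′ ∷ c′ ∷ d′ ∷ [] →
             majority a b c d ≡ majority a′ b′ c′ d′
majority-↭ {a} {b} {c} {d} {a′} {b′} {c′} {d′} perm =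
  cong (3 ≤ᵇ_) (trans (assoc (b2n a) _ _ _) (trans (sum-↭ (↭-map⁺ b2n perm)) (sym (assoc (b2n a′) _ _ _))))
  where
  assoc : ∀ a b c d → a + b + c + d ≡ a + (b + (c + (d + 0)))
  assoc = solve-∀

majorities-↭ : ∀ {p} {a b c d a′ b′ c′ d′ : Vec Bool p} →
               a ∷ b ∷ c ∷ d ∷ [] ↭ a′ ∷ b′ ∷ c′ ∷ d′ ∷ [] →
               majorities a b c d ≡ majorities a′ b′ c′ d′
majorities-↭ {a = []} {[]} {[]} {[]} {[]} {[]} {[]} {[]} _ = refl
majorities-↭ {a = _ ∷ _} {_ ∷ _} {_ ∷ _} {_ ∷ _} {_ ∷ _} {_ ∷ _} {_ ∷ _} {_ ∷ _} perm =
  cong₂ _∷_ (majority-↭ (↭-map⁺ Vec.head perm)) (majorities-↭ (↭-map⁺ Vec.tail perm))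

-- The search finds exactly the consistent words

module _ (outcome : Test → Bool) where

  ∈-pushIf : ∀ {A : Set} b {x y : A} {xs} → y ∈ pushIf outcome b x xs ⇔ ((b ≡ true × y ≡ x) ⊎ y ∈ xs)
  ∈-pushIf false = mk⇔ inj₂ λ where (inj₁ (() , _))
                                    (inj₂ y∈) → y∈
  ∈-pushIf true  = mk⇔ (λ where (here y≡x) → inj₁ (refl , y≡x)
                                (there y∈) → inj₂ y∈)
                       (λ where (inj₁ (_ , y≡x)) → here y≡x
                                (inj₂ y∈)        → there y∈)

  sweep⁻ : ∀ {p} ws {acc} {b} {w : Vec Bool p} → b ∷ w ∈ sweep outcome ws acc →
           b ∷ w ∈ acc ⊎ (w ∈ ws × extends outcome p b w ≡ true)
  sweep⁻ []       w∈ = inj₁ w∈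
  sweep⁻ {p} (v ∷ ws) w∈ with sweep⁻ ws w∈
  ... | inj₂ (w∈ws , ok) = inj₂ (there w∈ws , ok)
  ... | inj₁ w∈₁ with Equivalence.to (∈-pushIf (extends outcome p true v)) w∈₁
  ... | inj₁ (ok , refl) = inj₂ (here refl , ok)
  ... | inj₂ w∈₂ with Equivalence.to (∈-pushIf (extends outcome p false v)) w∈₂
  ... | inj₁ (ok , refl) = inj₂ (here refl , ok)
  ... | inj₂ w∈₃ = inj₁ w∈₃

  sweep⁺ : ∀ {p} ws {acc} {b} {w : Vec Bool p} → b ∷ w ∈ acc ⊎ (w ∈ ws × extends outcome p b w ≡ true) →
           b ∷ w ∈ sweep outcome ws acc
  sweep⁺ []           (inj₁ w∈) = w∈
  sweep⁺ {p} (v ∷ ws) (inj₁ w∈) =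
    sweep⁺ ws (inj₁ (Equivalence.from (∈-pushIf (extends outcome p true v))
                       (inj₂ (Equivalence.from (∈-pushIf (extends outcome p false v)) (inj₂ w∈)))))
  sweep⁺ (v ∷ ws) (inj₂ (there w∈ , ok)) = sweep⁺ ws (inj₂ (w∈ , ok))
  sweep⁺ {p} (v ∷ ws) {b = true} (inj₂ (here refl , ok)) =
    sweep⁺ ws (inj₁ (Equivalence.from (∈-pushIf (extends outcome p true v)) (inj₁ (ok , refl))))
  sweep⁺ {p} (v ∷ ws) {b = false} (inj₂ (here refl , ok)) =
    sweep⁺ ws (inj₁ (Equivalence.from (∈-pushIf (extends outcome p true v))
                       (inj₂ (Equivalence.from (∈-pushIf (extends outcome p false v)) (inj₁ (ok , refl))))))

  unique-∷ : ∀ {A : Set} {x : A} {xs} → x ∉ xs → Unique xs → Unique (x ∷ xs)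
  unique-∷ x∉ xs! = ¬Any⇒All¬ _ x∉ ∷ xs!

  unique-pushIf : ∀ {A : Set} b {x : A} {xs} → x ∉ xs → Unique xs → Unique (pushIf outcome b x xs)
  unique-pushIf false _  xs! = xs!
  unique-pushIf true  x∉ xs! = unique-∷ x∉ xs!

  -- The last hypothesis says that accumulated words extend only prefixes already consumed. With
  -- distinct prefixes it is preserved, and the two extensions of one prefix differ in their leading
  -- bit.
  unique-sweep : ∀ {p} ws {acc : List (Vec Bool (suc p))} → Unique ws → Unique acc →
                 (∀ {b w} → b ∷ w ∈ acc → w ∉ ws) → Unique (sweep outcome ws acc)
  unique-sweep []       _  acc! _ = acc!
  unique-sweep {p} (v ∷ ws) {acc} vws!@(_ ∷ ws!) acc! fresh =
    unique-sweep ws ws!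
      (unique-pushIf (extends outcome p true v)
        (λ v∈ → [ (λ where (_ , ())) , (λ v∈acc → fresh v∈acc (here refl)) ]′
                  (Equivalence.to (∈-pushIf (extends outcome p false v)) v∈))
        (unique-pushIf (extends outcome p false v) (λ v∈ → fresh v∈ (here refl)) acc!))
      fresh′
    where
    fresh′ : ∀ {b w} → b ∷ w ∈ pushIf outcome (extends outcome p true v) (true ∷ v)
                                 (pushIf outcome (extends outcome p false v) (false ∷ v) acc) → w ∉ ws
    fresh′ w∈ w∈ws with Equivalence.to (∈-pushIf (extends outcome p true v)) w∈
    ... | inj₁ (_ , refl) = Unique[x∷xs]⇒x∉xs vws! w∈ws
    ... | inj₂ w∈₁ with Equivalence.to (∈-pushIf (extends outcome p false v)) w∈₁
    ... | inj₁ (_ , refl) = Unique[x∷xs]⇒x∉xs vws! w∈ws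
    ... | inj₂ w∈₂ = fresh w∈₂ (there w∈ws)

  unique-candidates : ∀ p → Unique (candidates outcome p)
  unique-candidates zero    = ((λ ()) ∷ []) ∷ [] ∷ []
  unique-candidates (suc p) = unique-sweep (candidates outcome p) (unique-candidates p) [] (λ ())

  extends⇔ : ∀ f p v m → extends outcome p v (word f m) ≡ true ⇔ (∀ i → i < m → outcome (p , i , f i , v) ≡ true)
  extends⇔ f p v zero    = mk⇔ (λ _ i ()) (λ _ → refl)
  extends⇔ f p v (suc m) = mk⇔ to from
    where
    to : extends outcome p v (word f (suc m)) ≡ true → ∀ i → i < suc m → outcome (p , i , f i , v) ≡ true
    to eq i (s≤s i≤m) with outcome (p , m , f m , v) in here≡ | m≤n⇒m<n∨m≡n i≤m
    ... | true | inj₁ i<m  = Equivalence.to (extends⇔ f p v m) eq i i<m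
    ... | true | inj₂ refl = here≡
    from : (∀ i → i < suc m → outcome (p , i , f i , v) ≡ true) → extends outcome p v (word f (suc m)) ≡ true
    from all rewrite all m ≤-refl = Equivalence.from (extends⇔ f p v m) (λ i i<m → all i (m≤n⇒m≤1+n i<m))

  Consistent : (ℕ → Bool) → ℕ → Set
  Consistent f p = ∀ k → k < p → ∀ i → i < k → outcome (k , i , f i , f k) ≡ true

  candidates⁻ : ∀ f p → word f (suc p) ∈ candidates outcome p → Consistent f (suc p)
  candidates⁻ f zero    _  zero    _ i ()
  candidates⁻ f zero    _  (suc k) (s≤s ()) i i<k
  candidates⁻ f (suc p) w∈ k (s≤s k≤p) i i<k with sweep⁻ (candidates outcome p) w∈ | m≤n⇒m<n∨m≡n k≤p
  ... | inj₂ (w∈′ , _) | inj₁ k<p  = candidates⁻ f p w∈′ k k<p i i<k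
  ... | inj₂ (_ , ok)  | inj₂ refl = Equivalence.to (extends⇔ f (suc p) (f (suc p)) (suc p)) ok i i<k

  candidates⁺ : ∀ f p → Consistent f (suc p) → word f (suc p) ∈ candidates outcome p
  candidates⁺ f zero    _ with f 0
  ... | false = here refl
  ... | true  = there (here refl)
  candidates⁺ f (suc p) con =
    sweep⁺ (candidates outcome p)
      (inj₂ (candidates⁺ f p (λ k k<p → con k (m≤n⇒m≤1+n k<p)) ,
             Equivalence.from (extends⇔ f (suc p) (f (suc p)) (suc p)) (con (suc p) ≤-refl)))

-- Outcomes of a set of defectives and the confinement of consistent words

covers : Test → ℕ → Bool
covers (p , i , b , v) j = does (bit j i ≟ᵇ b) ∧ does (bit j p ≟ᵇ v)

covers⇔ : ∀ p i b v j → covers (p , i , b , v) j ≡ true ⇔ (bit j i ≡ b × bit j p ≡ v)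
covers⇔ p i b v j with bit j i ≟ᵇ b | bit j p ≟ᵇ v
... | yes x | yes y = mk⇔ (λ _ → x , y) (λ _ → refl)
... | yes x | no ¬y = mk⇔ (λ ()) (λ (_ , y) → contradiction y ¬y)
... | no ¬x | _     = mk⇔ (λ ()) (λ (x , _) → contradiction x ¬x)

outcomes : List ℕ → Test → Bool
outcomes ss q = any (covers q) ss

outcomes⁻ : ∀ ss p i {b v} → outcomes ss (p , i , b , v) ≡ true → ∃[ s ] s ∈ ss × bit s i ≡ b × bit s p ≡ v
outcomes⁻ (s ∷ ss) p i {b} {v} eq with covers (p , i , b , v) s in cov
... | true  = s , here refl , Equivalence.to (covers⇔ p i b v s) cov
... | false with outcomes⁻ ss p i eq
... | s′ , s′∈ , x = s′ , there s′∈ , x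

outcomes⁺ : ∀ ss p i {b v s} → s ∈ ss → bit s i ≡ b → bit s p ≡ v → outcomes ss (p , i , b , v) ≡ true
outcomes⁺ (s ∷ ss) p i {b} {v} (here refl) x y rewrite Equivalence.from (covers⇔ p i b v s) (x , y) = refl
outcomes⁺ (s ∷ ss) p i {b} {v} (there s∈) x y with covers (p , i , b , v) s
... | true  = refl
... | false = outcomes⁺ ss p i s∈ x y

module _ (ss : List ℕ) where

  -- Tests concern only pairs of different positions. If `i` and `k` coincide, a partner is
  -- borrowed, position 0 or, for position 0 itself, position 1; hence the length of at least two.
  matched : ∀ {f p} → Consistent (outcomes ss) f (2 + p) → ∀ {i k} → i < 2 + p → k < 2 + p →
            ∃[ s ] s ∈ ss × bit s i ≡ f i × bit s k ≡ f k
  matched con {i} {k} i< k< with <-cmp i k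
  ... | tri< i<k _ _ = outcomes⁻ ss k i (con k k< i i<k)
  ... | tri> _ _ k<i with outcomes⁻ ss i k (con i i< k k<i)
  ...   | s , s∈ , x , y = s , s∈ , y , x
  matched con {zero}  {k} i< k< | tri≈ _ refl _ with outcomes⁻ ss 1 0 (con 1 (s≤s (s≤s z≤n)) 0 (s≤s z≤n))
  ...   | s , s∈ , x , _ = s , s∈ , x , x
  matched con {suc i} {k} i< k< | tri≈ _ refl _ with outcomes⁻ ss (suc i) 0 (con (suc i) i< 0 (s≤s z≤n))
  ...   | s , s∈ , _ , x = s , s∈ , x , x

  module _ (a b c : ℕ) (ss⊆ : ss ⊆ a ∷ b ∷ c ∷ []) where

    span : ∀ p → List (Vec Bool p)
    span p = A ∷ B ∷ C ∷ med A B C ∷ []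
      where
      A = word (bit a) p
      B = word (bit b) p
      C = word (bit c) p

    -- Otherwise f differs from two of a, b, c at some position and from the third at another,
    -- and no element of ss matches f at both positions.
    consistent⇒span : ∀ {f p} → Consistent (outcomes ss) f (2 + p) → word f (2 + p) ∈ span (2 + p)
    consistent⇒span {f} {p} con
      with agree? f (bit a) (2 + p) | agree? f (bit b) (2 + p) | agree? f (bit c) (2 + p)
         | agree? f (λ i → maj (bit a i) (bit b i) (bit c i)) (2 + p)
    ... | inj₁ eq | _ | _ | _ = here eq
    ... | inj₂ _ | inj₁ eq | _ | _ = there (here eq)
    ... | inj₂ _ | inj₂ _ | inj₁ eq | _ = there (there (here eq))
    ... | inj₂ _ | inj₂ _ | inj₂ _ | inj₁ eq =
      there (there (there (here (trans eq (word-med (bit a) (bit b) (bit c) (2 + p))))))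
    ... | inj₂ (i , i< , ≢a) | inj₂ (j , j< , ≢b) | inj₂ (k , k< , ≢c) | inj₂ (l , l< , ≢m)
      with avoid-maj (bit a l) (bit b l) (bit c l) ≢m
    ... | inj₁ (≢a′ , ≢b′) with matched con l< k<
    ...   | s , s∈ , x , y with ss⊆ s∈
    ...     | here refl                 = contradiction (sym x) ≢a′
    ...     | there (here refl)         = contradiction (sym x) ≢b′
    ...     | there (there (here refl)) = contradiction (sym y) ≢c
    consistent⇒span {f} {p} con
        | inj₂ (i , i< , ≢a) | inj₂ (j , j< , ≢b) | inj₂ (k , k< , ≢c) | inj₂ (l , l< , ≢m)
        | inj₂ (inj₁ (≢a′ , ≢c′)) with matched con l< j<
    ...   | s , s∈ , x , y with ss⊆ s∈
    ...     | here refl                 = contradiction (sym x) ≢a′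
    ...     | there (here refl)         = contradiction (sym y) ≢b
    ...     | there (there (here refl)) = contradiction (sym x) ≢c′
    consistent⇒span {f} {p} con
        | inj₂ (i , i< , ≢a) | inj₂ (j , j< , ≢b) | inj₂ (k , k< , ≢c) | inj₂ (l , l< , ≢m)
        | inj₂ (inj₂ (≢b′ , ≢c′)) with matched con l< i<
    ...   | s , s∈ , x , y with ss⊆ s∈
    ...     | here refl                 = contradiction (sym y) ≢a
    ...     | there (here refl)         = contradiction (sym x) ≢b′
    ...     | there (there (here refl)) = contradiction (sym x) ≢c′

    candidates⊆span : ∀ p → candidates (outcomes ss) (suc p) ⊆ span (2 + p)
    candidates⊆span p {w} w∈ =
      -- A word is the expansion of its own value, which presents it as a function on positions.
      subst (_∈ span (2 + p)) (word-val w)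
        (consistent⇒span (candidates⁻ (outcomes ss) (bit (val w)) (suc p)
          (subst (_∈ candidates (outcomes ss) (suc p)) (sym (word-val w)) w∈)))

    length-candidates≤4 : ∀ p → length (candidates (outcomes ss) p) ≤ 4
    -- The two words of length one are untested and need not lie in the span.
    length-candidates≤4 zero    = s≤s (s≤s z≤n)
    length-candidates≤4 (suc p) = unique-length (unique-candidates (outcomes ss) (suc p)) (candidates⊆span p)

    span⊆candidates : a ∈ ss → b ∈ ss → c ∈ ss → ∀ p → span (suc p) ⊆ candidates (outcomes ss) p
    span⊆candidates a∈ b∈ c∈ p = λ where
        (here refl)                 → present a∈
        (there (here refl))         → present b∈
        (there (there (here refl))) → present c∈
        (there (there (there (here refl)))) →
          subst (_∈ candidates (outcomes ss) p) (word-med (bit a) (bit b) (bit c) (suc p))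
            (candidates⁺ (outcomes ss) _ p λ k _ i _ → median-outcome k i)
      where
      present : ∀ {s} → s ∈ ss → word (bit s) (suc p) ∈ candidates (outcomes ss) p
      present {s} s∈ = candidates⁺ (outcomes ss) (bit s) p (λ k _ i _ → outcomes⁺ ss k i s∈ refl refl)
      median-outcome : ∀ k i → outcomes ss (k , i , maj (bit a i) (bit b i) (bit c i) ,
                                             maj (bit a k) (bit b k) (bit c k)) ≡ true
      median-outcome k i with meet-maj (bit a i) (bit b i) (bit c i) (bit a k) (bit b k) (bit c k)
      ... | inj₁ (x , y)        = outcomes⁺ ss k i a∈ x y
      ... | inj₂ (inj₁ (x , y)) = outcomes⁺ ss k i b∈ x y
      ... | inj₂ (inj₂ (x , y)) = outcomes⁺ ss k i c∈ x y

-- Removing a median that is not defective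

unique-kept : ∀ {p} m {ws : List (Vec Bool p)} → Unique ws → Unique (kept m ws)
unique-kept m = unique-filter⁺ (λ w → ¬? (suc (val w) ≟ m))

∈-kept : ∀ {p} m {ws : List (Vec Bool p)} {w} → w ∈ kept m ws ⇔ (w ∈ ws × suc (val w) ≢ m)
∈-kept m = mk⇔ (∈-filter⁻ (λ w → ¬? (suc (val w) ≟ m)))
               (λ (w∈ , w≢) → ∈-filter⁺ (λ w → ¬? (suc (val w) ≟ m)) w∈ w≢)

module _ {p} (L : List (Vec Bool p)) (L! : Unique L) (A B C : Vec Bool p) where

  private
    M : Vec Bool p
    M = med A B C

  module _ (L⊆ : L ⊆ A ∷ B ∷ C ∷ M ∷ []) (L⊇ : A ∷ B ∷ C ∷ M ∷ [] ⊆ L) where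

    -- If two of `A`, `B`, `C` coincide, their median is the repeated word. So a median outside the
    -- three forces four distinct words into `L`.
    median-present : length L ≤ 3 → M ∈ A ∷ B ∷ C ∷ []
    median-present ≤3 with DecMembership._∈?_ (≡-dec _≟ᵇ_) M (A ∷ B ∷ C ∷ [])
    ... | yes M∈ = M∈
    ... | no M∉  = contradiction (≤-trans (unique-length abcm! L⊇) ≤3) (λ { (s≤s (s≤s (s≤s ()))) })
      where
      A≢B : A ≢ B
      A≢B refl = M∉ (here (med-aab A C))
      A≢C : A ≢ C
      A≢C refl = M∉ (here (med-aba A B))
      B≢C : B ≢ C
      B≢C refl = M∉ (there (here (med-baa B A)))
      abcm! : Unique (A ∷ B ∷ C ∷ M ∷ [])
      abcm! = (A≢B ∷ A≢C ∷ (λ eq → M∉ (here (sym eq))) ∷ []) ∷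
              (B≢C ∷ (λ eq → M∉ (there (here (sym eq)))) ∷ []) ∷
              ((λ eq → M∉ (there (there (here (sym eq))))) ∷ []) ∷ [] ∷ []

    few : length L ≤ 3 → vote L ≡ 0 → ∀ w → w ∈ results L ⇔ w ∈ A ∷ B ∷ C ∷ []
    few ≤3 vote≡0 w = mk⇔ to from
      where
      to : w ∈ results L → w ∈ A ∷ B ∷ C ∷ []
      to w∈ with L⊆ (proj₁ (Equivalence.to (∈-kept (vote L)) w∈))
      ... | here eq                         = here eq
      ... | there (here eq)                 = there (here eq)
      ... | there (there (here eq))         = there (there (here eq))
      ... | there (there (there (here eq))) = subst (_∈ _) (sym eq) (median-present ≤3)
      from : w ∈ A ∷ B ∷ C ∷ [] → w ∈ results L
      from w∈ = Equivalence.from (∈-kept (vote L))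
        -- Codes are positive, so a vote of 0 removes nothing.
        (L⊇ (∈-++⁺ˡ w∈) , λ eq → 1+n≢0 (trans eq vote≡0))

    -- Four distinct words inside a list of length four exhaust it, so `A`, `B`, `C`, `M` are
    -- themselves distinct and dropping `M` loses none of the other three.
    all-four : vote L ≡ suc (val M) → length L ≡ 4 → ∀ w → w ∈ results L ⇔ w ∈ A ∷ B ∷ C ∷ []
    all-four vote≡ len w = mk⇔ to from
      where
      abcm! : Unique (A ∷ B ∷ C ∷ M ∷ [])
      abcm! = Unique-resp-↭ (setoid (Vec Bool p)) (↭⇒↭ₛ (↭-sym (unique-⊆-↭ L! L⊆ (≤-reflexive (sym len))))) L!
      to : w ∈ results L → w ∈ A ∷ B ∷ C ∷ []
      to w∈ with Equivalence.to (∈-kept (vote L)) w∈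
      ... | w∈L , w≢ with L⊆ w∈L
      ... | here eq                           = here eq
      ... | there (here eq)                   = there (here eq)
      ... | there (there (here eq))           = there (there (here eq))
      ... | there (there (there (here refl))) = contradiction (sym vote≡) w≢
      M∉ : M ∉ A ∷ B ∷ C ∷ []
      M∉ M∈ with abcm!
      ... | (_ ∷ _ ∷ A≢M ∷ []) ∷ (_ ∷ B≢M ∷ []) ∷ (C≢M ∷ []) ∷ _ with M∈
      ...   | here eq                 = A≢M (sym eq)
      ...   | there (here eq)         = B≢M (sym eq)
      ...   | there (there (here eq)) = C≢M (sym eq)
      from : w ∈ A ∷ B ∷ C ∷ [] → w ∈ results L
      from w∈ = Equivalence.from (∈-kept (vote L))
        (L⊇ (∈-++⁺ˡ w∈) ,
         λ eq → M∉ (subst (_∈ A ∷ B ∷ C ∷ []) (val-injective w M (suc-injective (trans eq vote≡))) w∈))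

results-correct : ∀ {p} (L : List (Vec Bool p)) → Unique L → ∀ A B C →
                  L ⊆ A ∷ B ∷ C ∷ med A B C ∷ [] → A ∷ B ∷ C ∷ med A B C ∷ [] ⊆ L →
                  ∀ w → w ∈ results L ⇔ w ∈ A ∷ B ∷ C ∷ []
results-correct L@(w₁ ∷ w₂ ∷ w₃ ∷ w₄ ∷ []) L! A B C L⊆ L⊇ =
  all-four L L! A B C L⊆ L⊇
    (cong (λ w → suc (val w))
      (trans (majorities-↭ (↭-sym (unique-⊆-↭ L! L⊆ ≤-refl))) (majorities-med A B C))) refl
results-correct L@(_ ∷ _ ∷ _ ∷ _ ∷ _ ∷ _) L! A B C L⊆ L⊇ with unique-length L! L⊆
... | s≤s (s≤s (s≤s (s≤s ())))
results-correct L@[]               L! A B C L⊆ L⊇ = few L L! A B C L⊆ L⊇ z≤n refl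
results-correct L@(_ ∷ [])         L! A B C L⊆ L⊇ = few L L! A B C L⊆ L⊇ (s≤s z≤n) refl
results-correct L@(_ ∷ _ ∷ [])     L! A B C L⊆ L⊇ = few L L! A B C L⊆ L⊇ (s≤s (s≤s z≤n)) refl
results-correct L@(_ ∷ _ ∷ _ ∷ []) L! A B C L⊆ L⊇ = few L L! A B C L⊆ L⊇ (s≤s (s≤s (s≤s z≤n))) refl

-- `a`, `b`, `c` may repeat, so one or two defectives are covered by padding.
results-spanned : ∀ ss a b c → a ∈ ss → b ∈ ss → c ∈ ss → ss ⊆ a ∷ b ∷ c ∷ [] → ∀ p w →
                 w ∈ results (candidates (outcomes ss) (suc p)) ⇔ w ∈ map (λ s → word (bit s) (2 + p)) ss
results-spanned ss a b c a∈ b∈ c∈ ss⊆ p w = mk⇔ to from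
  where
  spec : w ∈ results (candidates (outcomes ss) (suc p)) ⇔ w ∈ map (λ s → word (bit s) (2 + p)) (a ∷ b ∷ c ∷ [])
  spec = results-correct (candidates (outcomes ss) (suc p)) (unique-candidates (outcomes ss) (suc p)) _ _ _
           (candidates⊆span ss a b c ss⊆ p) (span⊆candidates ss a b c ss⊆ a∈ b∈ c∈ (suc p)) w
  abc⊆ : a ∷ b ∷ c ∷ [] ⊆ ss
  abc⊆ (here refl)                 = a∈
  abc⊆ (there (here refl))         = b∈
  abc⊆ (there (there (here refl))) = c∈
  to : w ∈ results (candidates (outcomes ss) (suc p)) → w ∈ map (λ s → word (bit s) (2 + p)) ss
  to w∈ = ⊆-map⁺ _ abc⊆ (Equivalence.to spec w∈)
  from : w ∈ map (λ s → word (bit s) (2 + p)) ss → w ∈ results (candidates (outcomes ss) (suc p))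
  from w∈ = Equivalence.from spec (⊆-map⁺ _ ss⊆ w∈)

-- The empty set has no member to pad with. All its outcomes are negative, and already the pair of
-- positions 0 and 1 refutes every word.
no-candidates : ∀ p → candidates (outcomes []) (suc p) ≡ []
no-candidates p with candidates (outcomes []) (suc p) in eq
... | []    = refl
... | w ∷ _ = contradiction
  (candidates⁻ (outcomes []) (bit (val w)) (suc p)
    (subst (word (bit (val w)) (2 + p) ∈_) (sym eq) (here (word-val w))) 1 (s≤s (s≤s z≤n)) 0 (s≤s z≤n))
  λ ()

results-candidates : ∀ ss → length ss ≤ 3 → ∀ p w →
                     w ∈ results (candidates (outcomes ss) (suc p)) ⇔ w ∈ map (λ s → word (bit s) (2 + p)) ss
results-candidates [] _ p w rewrite no-candidates p = mk⇔ (λ ()) (λ ())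
results-candidates (a ∷ []) _ = results-spanned _ a a a (here refl) (here refl) (here refl)
  λ where (here eq) → here eq
results-candidates (a ∷ b ∷ []) _ = results-spanned _ a b b (here refl) (there (here refl)) (there (here refl)) ∈-++⁺ˡ
results-candidates (a ∷ b ∷ c ∷ []) _ =
  results-spanned _ a b c (here refl) (there (here refl)) (there (there (here refl))) (λ s∈ → s∈)
results-candidates (_ ∷ _ ∷ _ ∷ _ ∷ _) (s≤s (s≤s (s≤s ())))

spanned : ∀ ss → length ss ≤ 3 → ∃[ a ] ∃[ b ] ∃[ c ] ss ⊆ a ∷ b ∷ c ∷ []
-- Only an inclusion is required here, so arbitrary items serve.
spanned []               _ = 0 , 0 , 0 , λ ()
spanned (a ∷ [])         _ = a , a , a , ∈-++⁺ˡ
spanned (a ∷ b ∷ [])     _ = a , b , b , ∈-++⁺ˡ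
spanned (a ∷ b ∷ c ∷ []) _ = a , b , c , λ s∈ → s∈
spanned (_ ∷ _ ∷ _ ∷ _ ∷ _) (s≤s (s≤s (s≤s ())))

-- The matrix

elements : ∀ {n} → Subset n → List (Fin n)
elements []            = []
elements (inside ∷ S)  = Fin.zero ∷ map Fin.suc (elements S)
elements (outside ∷ S) = map Fin.suc (elements S)

length-elements : ∀ {n} (S : Subset n) → length (elements S) ≡ ∣ S ∣
length-elements []            = refl
length-elements (inside ∷ S)  = cong suc (trans (length-map Fin.suc (elements S)) (length-elements S))
length-elements (outside ∷ S) = trans (length-map Fin.suc (elements S)) (length-elements S)

∈-elements⁺ : ∀ {n} (S : Subset n) {j} → j ∈ˢ S → j ∈ elements S
∈-elements⁺ (inside ∷ S)  {Fin.zero}  _  = here refl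
∈-elements⁺ (outside ∷ S) {Fin.zero}  ()
∈-elements⁺ (inside ∷ S)  {Fin.suc j} j∈ = there (∈-map⁺ Fin.suc (∈-elements⁺ S (drop-there j∈)))
∈-elements⁺ (outside ∷ S) {Fin.suc j} j∈ = ∈-map⁺ Fin.suc (∈-elements⁺ S (drop-there j∈))

∈-elements⁻ : ∀ {n} (S : Subset n) {j} → j ∈ elements S → j ∈ˢ S
∈-elements⁻ (inside ∷ S)  (here refl) = Vec.here
∈-elements⁻ (inside ∷ S)  (there j∈) with ∈-map⁻ Fin.suc j∈
... | _ , i∈ , refl = Vec.there (∈-elements⁻ S i∈)
∈-elements⁻ (outside ∷ S) j∈ with ∈-map⁻ Fin.suc j∈
... | _ , i∈ , refl = Vec.there (∈-elements⁻ S i∈)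

unique-elements : ∀ {n} (S : Subset n) → Unique (elements S)
unique-elements []            = []
unique-elements (inside ∷ S)  = ¬Any⇒All¬ _ zero∉ ∷ unique-map⁺ fsuc-injective (unique-elements S)
  where
  zero∉ : Fin.zero ∉ map Fin.suc (elements S)
  zero∉ z∈ with ∈-map⁻ Fin.suc z∈
  ... | _ , _ , ()
unique-elements (outside ∷ S) = unique-map⁺ fsuc-injective (unique-elements S)

items : ∀ {n} → Subset n → List ℕ
items S = map toℕ (elements S)

any-map : ∀ {A B : Set} (f : A → B) p xs → any p (map f xs) ≡ any (λ x → p (f x)) xs
any-map f p []       = refl
any-map f p (x ∷ xs) = cong (p (f x) ∨_) (any-map f p xs)

positive : ∀ {n} (S : Subset n) g → foldr′ _∨_ false (zipWith _∧_ S (tabulate g)) ≡ any g (elements S)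
positive []            g = refl
positive (inside ∷ S)  g = cong (g Fin.zero ∨_)
  (trans (positive S (λ j → g (Fin.suc j))) (sym (any-map Fin.suc g (elements S))))
positive (outside ∷ S) g = trans (positive S (λ j → g (Fin.suc j))) (sym (any-map Fin.suc g (elements S)))

bits-map-tabulate : ∀ {A : Set} {t} (h : A → Bool) (g : ℕ → A) r → r < t →
                    bits (Vec.map h (tabulate {n = t} (λ i → g (toℕ i)))) r ≡ b2n (h (g r))
bits-map-tabulate {t = suc t} h g zero    _         = refl
bits-map-tabulate {t = suc t} h g (suc r) (s≤s r<t) = bits-map-tabulate h (λ i → g (suc i)) r r<t

-- The number of rows is left free, so that the closed form of the number of tests enters through an
-- equation on `t` and the matrix is never transported.
pairs : ∀ {t n} → Matrix t n
pairs = tabulate λ r → tabulate λ j → covers (test (toℕ r)) (toℕ j)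

bits-booleanSum : ∀ {t n} (S : Subset n) r → r < t → bits (booleanSum (pairs {t}) S) r ≡ b2n (outcomes (items S) (test r))
bits-booleanSum S r r<t =
  trans (bits-map-tabulate _ (λ r → tabulate λ j → covers (test r) (toℕ j)) r r<t)
        (cong b2n (trans (positive S _) (sym (any-map toℕ (covers (test r)) (elements S)))))

blocks≡ : ∀ q → 2 * q ^ 2 ∸ 2 * q ≡ blocks q
blocks≡ q = trans (cong (_∸ 2 * q) (sym (closed q))) (m+n∸n≡m (blocks q) (2 * q))
  where
  regroup₁ : ∀ b q → b + q * 4 + 2 * (1 + q) ≡ b + 2 * q + (q * 4 + 2)
  regroup₁ = solve-∀
  regroup₂ : ∀ q → 2 * (q * (q * 1)) + (q * 4 + 2) ≡ 2 * ((1 + q) * ((1 + q) * 1))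
  regroup₂ = solve-∀
  closed : ∀ q → blocks q + 2 * q ≡ 2 * q ^ 2
  closed zero    = refl
  closed (suc q) = trans (regroup₁ (blocks q) q) (trans (cong (_+ (q * 4 + 2)) (closed q)) (regroup₂ q))

-- Separability and the analysis of each matrix

analyses⇒separable : ∀ {t n d c w P} {M : Matrix t n} → Analyses d c w P M → Separable d M
analyses⇒separable analyses S T S≤ T≤ eq with analyses S S≤ | analyses T T≤
... | _ , s , run , _ , #S , ∈S | _ , s′ , run′ , _ , #T , ∈T
  with refl ← run-deterministic (subst (λ b → Run _ _ (initial _ b) _ _) eq run) run′ = ⊆-antisym
    (λ {j} j∈ → Equivalence.from (∈T j) (subst (λ k → ∃[ i ] i < k × _) ∣S∣≡∣T∣ (Equivalence.to (∈S j) j∈)))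
    (λ {j} j∈ → Equivalence.from (∈S j) (subst (λ k → ∃[ i ] i < k × _) (sym ∣S∣≡∣T∣) (Equivalence.to (∈T j) j∈)))
  where
  ∣S∣≡∣T∣ : ∣ S ∣ ≡ ∣ T ∣
  ∣S∣≡∣T∣ = trans (sym #S) #T

module _ {q} (S : Subset (2 ^ q)) where

  words : List (Vec Bool q)
  words = map (λ s → word (bit s) q) (items S)

  map-val-words : map val words ≡ items S
  map-val-words = begin
    map val words                                           ≡⟨ map-∘ (items S) ⟨
    map (λ s → val (word (bit s) q)) (map toℕ (elements S)) ≡⟨ map-∘ (elements S) ⟨
    map (λ j → val (word (bit (toℕ j)) q)) (elements S)     ≡⟨ map-cong (λ j → val-word q (toℕ<n j)) (elements S) ⟩
    items S                                                 ∎
    where open ≡-Reasoning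

  unique-words : Unique words
  unique-words = unique-map⁻ (subst Unique (sym map-val-words) (unique-map⁺ toℕ-injective (unique-elements S)))

  length-words : length words ≡ ∣ S ∣
  length-words = trans (length-map _ (items S)) (trans (length-map toℕ (elements S)) (length-elements S))

  ∈-words : ∀ j → j ∈ˢ S ⇔ toℕ j ∈ map val words
  ∈-words j = mk⇔
    (λ j∈ → subst (toℕ j ∈_) (sym map-val-words) (∈-map⁺ toℕ (∈-elements⁺ S j∈)))
    from
    where
    from : toℕ j ∈ map val words → j ∈ˢ S
    from j∈ with ∈-map⁻ toℕ (subst (toℕ j ∈_) map-val-words j∈)
    ... | i , i∈ , eq with refl ← toℕ-injective eq = ∈-elements⁻ S i∈

analyses : ∀ q {t} → 2 ≤ q → t ≡ blocks q → Analyses {t} {2 ^ q} 3 232 2 decoder pairs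
analyses (suc zero) (s≤s ())
analyses q@(suc (suc p)) 2≤q refl S S≤3 =
  let #items≤3 = ≤-trans (≤-reflexive (trans (length-map toℕ (elements S)) (length-elements S))) S≤3
      a , b , c , ss⊆ = spanned (items S) #items≤3
      μ′ , l , count , written , e =
        exec-decoder (outcomes (items S)) q (bits (booleanSum (pairs {blocks q}) S)) 2≤q
          (bits-booleanSum S) (length-candidates≤4 (items S) a b c ss⊆)
      R = results (candidates (outcomes (items S)) (suc p))
      R⇔ : ∀ w → w ∈ R ⇔ w ∈ words {q} S
      R⇔ = results-candidates (items S) #items≤3 p
      -- Both lists are free of duplicates and have the same members, so their lengths bound each
      -- other.
      #R : length R ≡ ∣ S ∣
      #R = trans (≤-antisym
                   (unique-length (unique-kept (vote (candidates (outcomes (items S)) (suc p)))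
                                    (unique-candidates (outcomes (items S)) (suc p)))
                                  (λ {w} → Equivalence.to (R⇔ w)))
                   (unique-length (unique-words {q} S) (λ {w} → Equivalence.from (R⇔ w))))
                 (length-words {q} S)
      k , ρ′ , run , k≤ , _ = Exec.run e (initial-registers)
  in k , ⟨ ρ′ , μ′ ⟩ , run , k≤ , trans count #R ,
     λ j → mk⇔
       (λ j∈ → subst (λ k → Written μ′ k (toℕ j)) #R
                 (Equivalence.from (written (toℕ j))
                   (⊆-map⁺ val (λ {w} → Equivalence.from (R⇔ w)) (Equivalence.to (∈-words {q} S j) j∈))))
       (λ wr → Equivalence.from (∈-words {q} S j)
                 (⊆-map⁺ val (λ {w} → Equivalence.to (R⇔ w))
                   (Equivalence.to (written (toℕ j)) (subst (λ k → Written μ′ k (toℕ j)) (sym #R) wr))))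
  where
  initial-registers : ∀ {n t} → ((λ _ → 0) [ 0 ↦ n ]) [ 1 ↦ t ] ≗ nth (n ∷ t ∷ [])
  initial-registers zero          = refl
  initial-registers (suc zero)    = refl
  initial-registers (suc (suc i)) = refl

theorem4 : Σ[ M ∈ ((q : ℕ) → Matrix (2 * q ^ 2 ∸ 2 * q) (2 ^ q)) ]
    (∀ q → 2 ≤ q → Separable 3 (M q)) ×
    TimeOptimal 3 (λ (i : ∃ (2 ≤_)) → M (proj₁ i))
theorem4 =
  (λ q → pairs) ,
  (λ q 2≤q → analyses⇒separable {c = 232} {w = 2} (analyses q 2≤q (blocks≡ q))) ,
  decoder , 232 , 2 , λ (q , 2≤q) → analyses q 2≤q (blocks≡ q)
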